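{- For every $n\in\mathbb Z$ and every $j\in\{0,1,\dots,r+1\}$, $$c_j=Z_j^{(G_r)}\bigl(y_{1,n},y_{2,n},\dots,y_{2r+1,n}\bigr),$$ where $c_j$ are the conserved quantities defined below. In particular, taking $n=0$, $c_j$ is the $j$-particle hard particle partition function on $G_r$ with vertex weights $y_{2\alpha-1}=\frac{R_{\alpha-1,0}R_{\alpha,1}}{R_{\alpha,0}R_{\alpha-1,1}}$ ($1\le\alpha\le r+1$) and $y_{2\alpha}=\frac{R_{\alpha-1,0}R_{\alpha+1,1}}{R_{\alpha,0}R_{\alpha,1}}$ ($1\le\alpha\le r$).
   Context: Fix $r\ge1$, $I_r=\{1,\dots,r\}$. Let $R_{1,0},\dots,R_{r,0},R_{1,1},\dots,R_{r,1}$ be algebraically independent indeterminates over $\mathbb Q$ and $(R_{\alpha,n})_{0\le\alpha\le r+1,n\in\mathbb Z}$ the $A_r$ $Q$-system: the unique family of nonzero elements of $\mathbb Q(R_{1,0},\dots,R_{r,1})$ with these initial values, $R_{0,n}=R_{r+1,n}=1$, and $R_{\alpha,n+1}R_{\alpha,n-1}=R_{\alpha,n}^2+R_{\alpha+1,n}R_{\alpha-1,n}$ ($\alpha\in I_r$, $n\in\mathbb Z$). Conserved quantities: for $k\in\{0,\dots,r+1\}$, $c_k$ is the determinant of the matrix obtained from the $(r+2)\times(r+2)$ matrix $(R_{1,n+i+j-r-3})_{1\le i,j\le r+2}$ by deleting row $r+2$ and column $r+2-k$; this is independent of $n$. Weights: $y_{2\alpha-1,n}=\frac{R_{\alpha-1,n}R_{\alpha,n+1}}{R_{\alpha,n}R_{\alpha-1,n+1}}$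 for $1\le\alpha\le r+1$ and $y_{2\alpha,n}=\frac{R_{\alpha-1,n}R_{\alpha+1,n+1}}{R_{\alpha,n}R_{\alpha,n+1}}$ for $1\le\alpha\le r$. The graph $G_r$ has vertices $1,\dots,2r+1$ and edges $\{1,2\}$, $\{2k,2k+1\}$ for $1\le k\le r$, and $\{2k-2,2k\}$, $\{2k-1,2k\}$ for $2\le k\le r$. A hard particle configuration on a graph is a set of vertices no two of which are joined by an edge. Given vertex weights $y_1,\dots,y_{2r+1}$, the weight of a configuration $C$ is $\prod_{i\in C}y_i$; $Z_j^{(G_r)}(y_1,\dots,y_{2r+1})$ denotes the sum of the weights of all hard particle configurations on $G_r$ of cardinality $j$. -}

module Defs where

open import Algebra.Apartness.Bundles using (HeytingField; HeytingCommutativeRing)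
open import Algebra.Bundles using (CommutativeRing; Semiring)
open import Algebra.Definitions.RawMonoid using (sum)
open import Algebra.Morphism.Structures using (IsRingHomomorphism)
import Algebra.Apartness.Properties.HeytingCommutativeRing as HCR
import Algebra.Definitions.RawSemiring as RawSemiringOps
open import Data.Bool.Base using (if_then_else_)
open import Data.Fin.Base using (Fin; zero; suc; toℕ; fromℕ; inject₁; opposite; punchIn)
open import Data.Fin.Properties using (all?)
open import Data.Fin.Subset using (Subset; inside; outside; _∈_; ∣_∣)
open import Data.Fin.Subset.Properties using (_∈?_)
open import Data.Integer.Base as ℤ using (ℤ; +_; 0ℤ; 1ℤ)
open import Data.List.Base as List using (List; []; _∷_; _++_; applyUpTo; filter)
open import Data.List.Membership.Propositional using () renaming (_∈_ to _∈ˡ_)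
import Data.List.Membership.DecPropositional as DecMembership
open import Data.List.Relation.Unary.Any using (Any)
open import Data.List.Relation.Unary.Unique.Propositional using (Unique)
open import Data.Nat.Base as ℕ using (ℕ; zero; suc)
import Data.Nat.Properties as ℕ
open import Data.Product.Base using (_×_; _,_; proj₁; proj₂; ∃₂)
open import Data.Product.Properties using (≡-dec)
open import Data.Rational.Base as ℚ using (ℚ; 0ℚ)
open import Data.Sum.Base as Sum using (_⊎_; inj₁; inj₂; [_,_]′)
open import Data.Vec.Base as Vec using (Vec; []; _∷_)
open import Level using (Level; 0ℓ; _⊔_)
open import Relation.Binary.Core using (Rel)
open import Relation.Binary.Definitions using (Decidable)
open import Relation.Binary.PropositionalEquality.Core using (_≢_)
open import Relation.Nullary.Decidable.Core using (Dec; _×-dec_; _→-dec_; ¬?)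
open import Relation.Nullary.Negation.Core using (¬_)

subsets : ∀ n → List (Subset n)
subsets zero    = [] ∷ []
subsets (suc n) = List.map (inside ∷_) (subsets n) ++ List.map (outside ∷_) (subsets n)

module _ {n : ℕ} (_~_ : Rel (Fin n) 0ℓ) (_~?_ : Decidable _~_) where

  IsHard : Subset n → Set
  IsHard C = ∀ u v → u ∈ C → v ∈ C → ¬ (u ~ v)

  isHard? : ∀ C → Dec (IsHard C)
  isHard? C = all? λ u → all? λ v → (u ∈? C) →-dec ((v ∈? C) →-dec ¬? (u ~? v))

  hardConfigurations : ℕ → List (Subset n)
  hardConfigurations j = filter (λ C → isHard? C ×-dec (∣ C ∣ ℕ.≟ j)) (subsets n)

-- The graph G_r.  The vertex 1 ≤ i ≤ 2r+1 is the element of Fin (1 + r * 2)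
-- whose label is i.
Vertex : ℕ → Set
Vertex r = Fin (suc (r ℕ.* 2))

label : ∀ {n} → Fin n → ℕ
label i = suc (toℕ i)

-- Each edge is listed once, in one orientation; IsHard tests both.
-- The index k below runs over 1, …, r and over 2, …, r respectively.
edges : ℕ → List (ℕ × ℕ)
edges r = (1 , 2)
  ∷ List.map (λ k → 2 ℕ.* k , 2 ℕ.* k ℕ.+ 1) (applyUpTo (1 ℕ.+_) r)
  ++ List.map (λ k → 2 ℕ.* k ℕ.∸ 2 , 2 ℕ.* k) (applyUpTo (2 ℕ.+_) (r ℕ.∸ 1))
  ++ List.map (λ k → 2 ℕ.* k ℕ.∸ 1 , 2 ℕ.* k) (applyUpTo (2 ℕ.+_) (r ℕ.∸ 1))

Adjacent : ∀ r → Rel (Vertex r) 0ℓ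
Adjacent r u v = (label u , label v) ∈ˡ edges r

adjacent? : ∀ r → Decidable (Adjacent r)
adjacent? r u v = (label u , label v) ∈ˡ? edges r
  where open DecMembership (≡-dec ℕ._≟_ ℕ._≟_) using () renaming (_∈?_ to _∈ˡ?_)

-- inj₁ α stands for the vertex 2 (label α) - 1, and inj₂ α for the vertex 2 (label α).
parity : ∀ r → Vertex r → Fin (suc r) ⊎ Fin r
parity r       zero          = inj₁ zero
parity (suc r) (suc zero)    = inj₂ zero
parity (suc r) (suc (suc v)) = Sum.map suc suc (parity r v)

-- A polynomial in m indeterminates over ℚ: coefficients paired with
-- pairwise distinct exponent vectors.
record Polynomial (m : ℕ) : Set where
  field
    terms    : List (ℚ × Vec ℕ m)
    distinct : Unique (List.map proj₂ terms)

open Polynomial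

NonZeroPolynomial : ∀ {m} → Polynomial m → Set
NonZeroPolynomial p = Any (λ t → proj₁ t ≢ 0ℚ) (terms p)

-- An index 0 ≤ α ≤ r+1 of the Q-system is toℕ of an element of Fin (2 + r).
-- An element α of Fin r stands for label α ∈ I_r; these are the indices
-- label α - 1, label α and label α + 1.
pred′ self′ succ′ : ∀ {r} → Fin r → Fin (suc (suc r))
pred′ α = inject₁ (inject₁ α)
self′ α = inject₁ (suc α)
succ′ α = suc (suc α)

module _ {c ℓ₁ ℓ₂ : Level} (K : HeytingField c ℓ₁ ℓ₂) where

  open HeytingField K using (Carrier; _≈_; _#_; _+_; _*_; -_; 0#; 1#; #⇒invertible; heytingCommutativeRing)
  open HeytingCommutativeRing heytingCommutativeRing using (commutativeRing)
  open CommutativeRing commutativeRing using (rawRing; semiring; +-rawMonoid; *-rawMonoid)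
  open RawSemiringOps (Semiring.rawSemiring semiring) using (_^_)
  open HCR heytingCommutativeRing using (x#0y#0→xy#0)

  -- The library provides the inverse of y - 0# rather than of y.
  divide : (x y : Carrier) → y # 0# → Carrier
  divide x y y#0 = x * proj₁ (#⇒invertible y#0)

  ∑ ∏ : ∀ {n} → (Fin n → Carrier) → Carrier
  ∑ = sum +-rawMonoid
  ∏ = sum *-rawMonoid

  evaluate : ∀ {m} → (ℚ → Carrier) → Polynomial m → (Fin m → Carrier) → Carrier
  evaluate ι p x = List.foldr _+_ 0# (List.map term (terms p))
    where
    term : ℚ × Vec ℕ _ → Carrier
    term (q , e) = ι q * ∏ (λ i → x i ^ Vec.lookup e i)

  -- K = ℚ(x₁, …, x_m) with x₁, …, x_m algebraically independent over ℚ.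
  record IsRationalFunctionField {m : ℕ} (x : Fin m → Carrier) : Set (c ⊔ ℓ₁ ⊔ ℓ₂) where
    field
      ι                        : ℚ → Carrier
      ι-isRingHomomorphism     : IsRingHomomorphism ℚ.+-*-rawRing rawRing ι
      algebraicallyIndependent : ∀ p → NonZeroPolynomial p → evaluate ι p x # 0#
      generated                : ∀ a → ∃₂ λ p q →
                                 evaluate ι q x # 0# × a * evaluate ι q x ≈ evaluate ι p x

  record IsQSystem {r : ℕ} (X₀ X₁ : Fin r → Carrier)
                   (R : Fin (suc (suc r)) → ℤ → Carrier) : Set (ℓ₁ ⊔ ℓ₂) where
    field
      nonzero  : ∀ α n → R α n # 0#
      initial₀ : ∀ α → R (self′ α) 0ℤ ≈ X₀ α
      initial₁ : ∀ α → R (self′ α) 1ℤ ≈ X₁ α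
      bottom   : ∀ n → R zero n ≈ 1#
      top      : ∀ n → R (fromℕ (suc r)) n ≈ 1#
      relation : ∀ α n →
        R (self′ α) (n ℤ.+ 1ℤ) * R (self′ α) (n ℤ.- 1ℤ)
          ≈ R (self′ α) n * R (self′ α) n + R (succ′ α) n * R (pred′ α) n

  submatrix : ∀ {n} → Fin (suc n) → Fin (suc n) →
              (Fin (suc n) → Fin (suc n) → Carrier) → (Fin n → Fin n → Carrier)
  submatrix row col M i j = M (punchIn row i) (punchIn col j)

  -- Laplace expansion along the first row.
  det : ∀ n → (Fin n → Fin n → Carrier) → Carrier
  det zero    M = 1#
  det (suc n) M = ∑ λ j → (- 1#) ^ toℕ j * (M zero j * det n (submatrix zero j M))

  module _ {r : ℕ} (R : Fin (suc (suc r)) → ℤ → Carrier) where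

    hankel : ℤ → Fin (suc (suc r)) → Fin (suc (suc r)) → Carrier
    hankel n i j = R (suc zero) (n ℤ.+ + label i ℤ.+ + label j ℤ.- + (r ℕ.+ 3))

    -- Computed from the matrix at n.  The deleted row and column have labels
    -- r + 2 and r + 2 - toℕ k.
    conserved : ℤ → Fin (suc (suc r)) → Carrier
    conserved n k = det (suc r) (submatrix (fromℕ (suc r)) (opposite k) (hankel n))

  configurationWeight : ∀ {n} → (Fin n → Carrier) → Subset n → Carrier
  configurationWeight y C = ∏ λ i → if Vec.lookup C i then y i else 1#

  Z : ∀ r → ℕ → (Vertex r → Carrier) → Carrier
  Z r j y = List.foldr _+_ 0#
    (List.map (configurationWeight y) (hardConfigurations (Adjacent r) (adjacent? r) j))

  -- The weights as functions of A α = R_{α,n} and B α = R_{α,n+1}.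
  weights : ∀ {r} (A B : Fin (suc (suc r)) → Carrier) →
            (∀ α → A α # 0#) → (∀ α → B α # 0#) → Vertex r → Carrier
  weights {r} A B A#0 B#0 v = [ odd , even ]′ (parity r v)
    where
    odd : Fin (suc r) → Carrier
    odd α = divide (A (inject₁ α) * B (suc α)) (A (suc α) * B (inject₁ α))
                   (x#0y#0→xy#0 (A#0 (suc α)) (B#0 (inject₁ α)))

    even : Fin r → Carrier
    even α = divide (A (pred′ α) * B (succ′ α)) (A (self′ α) * B (self′ α))
                    (x#0y#0→xy#0 (A#0 (self′ α)) (B#0 (self′ α)))

  module _ {r : ℕ} {X₀ X₁ : Fin r → Carrier} {R : Fin (suc (suc r)) → ℤ → Carrier}
           (Q : IsQSystem X₀ X₁ R) where

    open IsQSystem Q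

    y : ℤ → Vertex r → Carrier
    y n = weights (λ α → R α n) (λ α → R α (n ℤ.+ 1ℤ))
                  (λ α → nonzero α n) (λ α → nonzero α (n ℤ.+ 1ℤ))

    y⁰ : Vertex r → Carrier
    y⁰ = weights (λ α → R α 0ℤ) (λ α → R α 1ℤ)
                 (λ α → nonzero α 0ℤ) (λ α → nonzero α 1ℤ)

{-# OPTIONS --safe #-}

-- Put t for minus the backward shift of the sequence a_k = R_{1,k}.  Splitting
-- off the last vertices of G_m gives the three-term recursion
--   F_m = (1 + t y_{2m+1}) F_{m-1} + t y_{2m} F_{m-2}
-- for the generating function F_m of the hard configurations.  The Q-system
-- implies exchange relations between the weights at n and at n + 1, and hence
--   F_m^{n+1} = F_m^n + t y_{2m+2,n} F_{m-1}^n,   where y_{2r+2} = 0.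
-- Therefore the first value of F_m^n a after a zero is a quotient of two R's.
-- Three consequences: F_r^n does not depend on n and annihilates the whole
-- sequence a; the (r+1) x (r+1) Hankel determinant of a telescopes to
-- R_{r+1} = 1 under operations between neighbouring columns; and by Cramer's
-- rule the minors c_j are then the coefficients of F_r, that is Z_j.
module Submission where

open import Defs
open import Algebra.Apartness.Bundles using (HeytingField; HeytingCommutativeRing)
import Algebra.Apartness.Properties.HeytingCommutativeRing as HeytingCommutativeRingProperties
open import Algebra.Bundles using (CommutativeRing; Semiring)
import Algebra.Definitions.RawSemiring as RawSemiringOps
import Algebra.Properties.AbelianGroup as AbelianGroupProperties
import Algebra.Properties.CommutativeMonoid.Sum as CommutativeMonoidSum
import Algebra.Properties.Ring as RingProperties
import Algebra.Properties.Semiring.Exp as SemiringExp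
import Algebra.Properties.Semiring.Sum as SemiringSum
import Algebra.Solver.Ring.NaturalCoefficients.Default as SemiringSolver
open import Data.Bool.Base using (Bool; true; false; if_then_else_; not; _∧_; _∨_; T)
open import Data.Bool.Properties using (T?; T-∧; ∨-zeroʳ)
open import Data.Fin.Base as Fin using (Fin; zero; suc; toℕ; fromℕ; fromℕ<; inject₁; opposite; punchIn; punchOut)
import Data.Fin.Permutation as Permutation
import Data.Fin.Properties as Fin
open import Data.Fin.Subset using (Subset; inside; outside; _∈_; ∣_∣)
open import Data.Integer.Base as ℤ using (ℤ; +_; -[1+_]; 0ℤ; 1ℤ; -1ℤ)
import Data.Integer.Properties as ℤ
import Data.Integer.Solver as IntegerSolver
open import Data.List.Base as List using (List; []; _∷_; applyUpTo; filter)
open import Data.List.Membership.Propositional using () renaming (_∈_ to _∈ˡ_)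
open import Data.List.Membership.Propositional.Properties using (∈-map⁻; ∈-map⁺; ∈-++⁻; ∈-++⁺ˡ; ∈-++⁺ʳ; ∈-applyUpTo⁻; ∈-applyUpTo⁺)
import Data.List.Properties as List
import Data.List.Relation.Unary.Any as Any
open import Data.Nat.Base as ℕ using (ℕ; zero; suc; _≤_; _≡ᵇ_)
import Data.Nat.Properties as ℕ
open import Data.Product.Base using (∃; _×_; _,_; proj₁; proj₂)
open import Data.Product.Properties using (,-injective)
open import Data.Sum.Base as Sum using (_⊎_; inj₁; inj₂)
open import Data.Vec.Base using ([]; _∷_; here; there)
open import Data.Vec.Functional using (_++_; updateAt)
open import Data.Vec.Functional.Properties using (updateAt-updates; updateAt-minimal)
open import Function.Base using (_∘_; const)
open import Function.Bundles using (Equivalence; mk⇔)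
open import Level using (Level)
open import Relation.Binary.Definitions using (tri<; tri≈; tri>)
open import Relation.Binary.PropositionalEquality as ≡ using (_≡_; _≢_)
import Relation.Binary.Reasoning.Setoid as SetoidReasoning
open import Relation.Nullary.Decidable using (yes; no; does; does-⇔; dec-true; dec-false)
open import Relation.Nullary.Negation.Core using (¬_; contradiction)
open import Relation.Unary using (Pred; Decidable)

-- Determinants

-- By Cramer's rule the maximal minors of a Hankel matrix with a kernel vector are the entries of
-- that vector up to alternating signs, whereas `Z` has no signs. Taking t to be minus the shift
-- supplies a second family of alternating signs, and the two cancel. The Hankel matrix itself
-- involves no weights, hence no time n, yet its column l is assigned the time n + l. At the lowest
-- level this costs nothing, because `q 1` ignores its time. At the later levels it is what makes
-- the reduction work: the zero of F_m^n a sits at an index that moves with n exactly as the entries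
-- of the first row move with l. One round of column operations therefore clears the whole first row
-- except its corner, and the corner contributes the quotient that telescopes.

m<n⇒n≡1+[n∸1+m]+m : ∀ {m n} → m ℕ.< n → n ≡ suc (n ℕ.∸ suc m ℕ.+ m)
m<n⇒n≡1+[n∸1+m]+m {m} m<n = ≡.trans (≡.sym (ℕ.m∸n+n≡m m<n)) (ℕ.+-suc _ m)

-- Serves to compare the minors obtained by striking out either of two neighbouring columns: they
-- differ in at most one column, which holds the one or the other of the two.
punchIn-adjacent : ∀ {n} (p : Fin (suc n)) (j : Fin (suc n)) →
  punchIn (inject₁ p) j ≡ punchIn (suc p) j ⊎
  (punchIn (inject₁ p) j ≡ suc p × punchIn (suc p) j ≡ inject₁ p)
punchIn-adjacent zero zero = inj₂ (≡.refl , ≡.refl)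
punchIn-adjacent zero (suc j) = inj₁ ≡.refl
punchIn-adjacent (suc p) zero = inj₁ ≡.refl
punchIn-adjacent {suc n} (suc p) (suc j) with punchIn-adjacent p j
... | inj₁ e = inj₁ (≡.cong suc e)
... | inj₂ (e , e′) = inj₂ (≡.cong suc e , ≡.cong suc e′)

-- Neighbouring columns stay neighbours when a third one is struck out; the induction in
-- `det-adjacent-equal` rests on this.
adjacent-punchIn : ∀ {n} (p : Fin (suc n)) (j : Fin (suc (suc n))) →
  j ≢ inject₁ p → j ≢ suc p →
  ∃ λ p′ → punchIn j (inject₁ p′) ≡ inject₁ p × punchIn j (suc p′) ≡ suc p
adjacent-punchIn zero zero j≢p _ = contradiction ≡.refl j≢p
adjacent-punchIn zero (suc zero) _ j≢p⁺ = contradiction ≡.refl j≢p⁺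
adjacent-punchIn {suc n} zero (suc (suc j)) _ _ = zero , ≡.refl , ≡.refl
adjacent-punchIn (suc p) zero _ _ = p , ≡.refl , ≡.refl
adjacent-punchIn {suc n} (suc p) (suc j) j≢p j≢p⁺
  with adjacent-punchIn p j (j≢p ∘ ≡.cong suc) (j≢p⁺ ∘ ≡.cong suc)
... | p′ , e , e⁺ = suc p′ , ≡.cong suc e , ≡.cong suc e⁺

module Determinant {c ℓ₁ ℓ₂} (K : HeytingField c ℓ₁ ℓ₂) where

  open HeytingCommutativeRing (HeytingField.heytingCommutativeRing K) using (commutativeRing)
  open CommutativeRing commutativeRing hiding (zero)
  open RawSemiringOps (Semiring.rawSemiring semiring) using (_^_)
  open CommutativeMonoidSum +-commutativeMonoid
    using (sum-remove; sum-cong-≋; sum-replicate-zero; ∑-distrib-+)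
  open SemiringSum semiring using (*-distribˡ-sum)
  open RingProperties ring using (-1*x≈-x)
  open SemiringSolver commutativeSemiring using (solve; _:+_; _:*_; _:=_)
  open SetoidReasoning setoid

  Matrix : ℕ → Set c
  Matrix n = Fin n → Fin n → Carrier

  sum-zero : ∀ {n} (f : Fin n → Carrier) → (∀ i → f i ≈ 0#) → ∑ K f ≈ 0#
  sum-zero {n} f f≈0 = trans (sum-cong-≋ f≈0) (sum-replicate-zero n)

  sum-single : ∀ {n} (i : Fin n) (f : Fin n → Carrier) →
    (∀ j → j ≢ i → f j ≈ 0#) → ∑ K f ≈ f i
  sum-single {suc n} i f f≈0 = begin
    ∑ K f                      ≈⟨ sum-remove {i = i} f ⟩
    f i + ∑ K (f ∘ punchIn i)  ≈⟨ +-congˡ (sum-zero _ λ j → f≈0 _ (Fin.punchInᵢ≢i i j)) ⟩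
    f i + 0#                   ≈⟨ +-identityʳ _ ⟩
    f i                        ∎

  sum-adjacent-cancel : ∀ {n} (p : Fin n) (f : Fin (suc n) → Carrier) →
    f (inject₁ p) + f (suc p) ≈ 0# →
    (∀ j → j ≢ inject₁ p → j ≢ suc p → f j ≈ 0#) → ∑ K f ≈ 0#
  sum-adjacent-cancel {suc n} zero f cancel f≈0 = begin
    f zero + (f (suc zero) + ∑ K rest)  ≈⟨ +-assoc _ _ _ ⟨
    f zero + f (suc zero) + ∑ K rest
      ≈⟨ +-cong cancel (sum-zero rest λ j → f≈0 (suc (suc j)) (λ ()) λ ()) ⟩
    0# + 0#                             ≈⟨ +-identityʳ _ ⟩
    0#                                  ∎
    where
    rest : Fin n → Carrier
    rest j = f (suc (suc j))
  sum-adjacent-cancel (suc p) f cancel f≈0 = begin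
    f zero + ∑ K (f ∘ suc)
      ≈⟨ +-cong (f≈0 zero (λ ()) λ ())
           (sum-adjacent-cancel p (f ∘ suc) cancel λ j j≢p j≢p⁺ →
             f≈0 (suc j) (j≢p ∘ Fin.suc-injective) (j≢p⁺ ∘ Fin.suc-injective)) ⟩
    0# + 0#                 ≈⟨ +-identityʳ _ ⟩
    0#                      ∎

  det-cong : ∀ n {M N : Matrix n} → (∀ i j → M i j ≈ N i j) → det K n M ≈ det K n N
  det-cong zero    M≈N = refl
  det-cong (suc n) M≈N = sum-cong-≋ λ j →
    *-congˡ {(- 1#) ^ toℕ j} (*-cong (M≈N zero j) (det-cong n λ i k → M≈N (suc i) (punchIn j k)))

  -- In the expansion along the first row the term `j = q` is linear through its entry, since its
  -- minor no longer contains column `q`. Every other term is linear through its minor, by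
  -- induction. Entrywise hypotheses on three separate matrices make the lemma applicable to
  -- matrices that are only pointwise equal to column replacements.
  det-linear : ∀ n (q : Fin n) {L M N : Matrix n} (a b : Carrier) →
    (∀ i → L i q ≈ a * M i q + b * N i q) →
    (∀ i j → j ≢ q → L i j ≈ M i j) → (∀ i j → j ≢ q → L i j ≈ N i j) →
    det K n L ≈ a * det K n M + b * det K n N
  det-linear (suc n) q {L} {M} {N} a b at-q L≈M L≈N = begin
    ∑ K (term L)                                ≈⟨ sum-cong-≋ expand ⟩
    ∑ K (λ j → a * term M j + b * term N j)     ≈⟨ ∑-distrib-+ (λ j → a * term M j) (λ j → b * term N j) ⟩
    ∑ K (λ j → a * term M j) + ∑ K (λ j → b * term N j)
      ≈⟨ +-cong (*-distribˡ-sum a (term M)) (*-distribˡ-sum b (term N)) ⟨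
    a * ∑ K (term M) + b * ∑ K (term N)         ∎
    where
    minor : Matrix (suc n) → Fin (suc n) → Carrier
    minor A j = det K n (submatrix K zero j A)
    term : Matrix (suc n) → Fin (suc n) → Carrier
    term A j = (- 1#) ^ toℕ j * (A zero j * minor A j)
    expand : ∀ j → term L j ≈ a * term M j + b * term N j
    expand j with j Fin.≟ q
    ... | yes ≡.refl = begin
      (- 1#) ^ toℕ j * (L zero j * minor L j)
        ≈⟨ *-congˡ (*-congʳ (at-q zero)) ⟩
      (- 1#) ^ toℕ j * ((a * M zero j + b * N zero j) * minor L j)
        ≈⟨ solve 6 (λ s a b x y m → s :* ((a :* x :+ b :* y) :* m)
             := a :* (s :* (x :* m)) :+ b :* (s :* (y :* m))) refl
             ((- 1#) ^ toℕ j) a b (M zero j) (N zero j) (minor L j) ⟩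
      a * ((- 1#) ^ toℕ j * (M zero j * minor L j)) + b * ((- 1#) ^ toℕ j * (N zero j * minor L j))
        ≈⟨ +-cong
             (*-congˡ (*-congˡ (*-congˡ (det-cong n λ i k → L≈M _ _ (Fin.punchInᵢ≢i j k)))))
             (*-congˡ (*-congˡ (*-congˡ (det-cong n λ i k → L≈N _ _ (Fin.punchInᵢ≢i j k))))) ⟩
      a * term M j + b * term N j ∎
    ... | no j≢q = begin
      (- 1#) ^ toℕ j * (L zero j * minor L j)
        ≈⟨ *-congˡ (*-congˡ (det-linear n (punchOut j≢q) a b
             (λ i → ≡.subst (λ l → L (suc i) l ≈ a * M (suc i) l + b * N (suc i) l)
                      (≡.sym (Fin.punchIn-punchOut j≢q)) (at-q (suc i)))
             (λ i k k≢ → L≈M _ _ (k≢ ∘ off k)) (λ i k k≢ → L≈N _ _ (k≢ ∘ off k)))) ⟩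
      (- 1#) ^ toℕ j * (L zero j * (a * minor M j + b * minor N j))
        ≈⟨ solve 6 (λ s a b x m n → s :* (x :* (a :* m :+ b :* n))
             := a :* (s :* (x :* m)) :+ b :* (s :* (x :* n))) refl
             ((- 1#) ^ toℕ j) a b (L zero j) (minor M j) (minor N j) ⟩
      a * ((- 1#) ^ toℕ j * (L zero j * minor M j)) + b * ((- 1#) ^ toℕ j * (L zero j * minor N j))
        ≈⟨ +-cong (*-congˡ (*-congˡ (*-congʳ (L≈M zero j j≢q))))
                  (*-congˡ (*-congˡ (*-congʳ (L≈N zero j j≢q)))) ⟩
      a * term M j + b * term N j ∎
      where
      off : ∀ k → punchIn j k ≡ q → k ≡ punchOut j≢q
      off k e = Fin.punchIn-injective j k _ (≡.trans e (≡.sym (Fin.punchIn-punchOut j≢q)))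

  det-additive : ∀ n (q : Fin n) {L M N : Matrix n} →
    (∀ i → L i q ≈ M i q + N i q) →
    (∀ i j → j ≢ q → L i j ≈ M i j) → (∀ i j → j ≢ q → L i j ≈ N i j) →
    det K n L ≈ det K n M + det K n N
  det-additive n q at-q L≈M L≈N =
    trans (det-linear n q 1# 1#
            (λ i → trans (at-q i) (sym (+-cong (*-identityˡ _) (*-identityˡ _)))) L≈M L≈N)
          (+-cong (*-identityˡ _) (*-identityˡ _))

  det-zero-column : ∀ n (q : Fin n) {M : Matrix n} → (∀ i → M i q ≈ 0#) → det K n M ≈ 0#
  det-zero-column n q {M} M≈0 = begin
    det K n M                        ≈⟨ det-linear n q 0# 0# at-q (λ _ _ _ → refl) (λ _ _ _ → refl) ⟩
    0# * det K n M + 0# * det K n M  ≈⟨ +-cong (zeroˡ _) (zeroˡ _) ⟩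
    0# + 0#                          ≈⟨ +-identityʳ _ ⟩
    0#                               ∎
    where
    at-q : ∀ i → M i q ≈ 0# * M i q + 0# * M i q
    at-q i = trans (M≈0 i) (sym (trans (+-cong (zeroˡ _) (zeroˡ _)) (+-identityʳ _)))

  -- In the first-row expansion the two equal columns have equal minors and opposite signs, and
  -- every other minor again has two equal neighbouring columns.
  det-adjacent-equal : ∀ {n} (p : Fin n) (M : Matrix (suc n)) →
    (∀ i → M i (inject₁ p) ≈ M i (suc p)) → det K (suc n) M ≈ 0#
  det-adjacent-equal {suc n} p M eq = sum-adjacent-cancel p _ cancel vanish
    where
    minor : Fin (suc (suc n)) → Carrier
    minor j = det K (suc n) (submatrix K zero j M)

    minors-agree : minor (inject₁ p) ≈ minor (suc p)
    minors-agree = det-cong (suc n) λ i j → entry i j (punchIn-adjacent p j)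
      where
      entry : ∀ i j → punchIn (inject₁ p) j ≡ punchIn (suc p) j ⊎
        (punchIn (inject₁ p) j ≡ suc p × punchIn (suc p) j ≡ inject₁ p) →
        M (suc i) (punchIn (inject₁ p) j) ≈ M (suc i) (punchIn (suc p) j)
      entry i j (inj₁ e) = reflexive (≡.cong (M (suc i)) e)
      entry i j (inj₂ (e , e′)) = begin
        M (suc i) (punchIn (inject₁ p) j)  ≡⟨ ≡.cong (M (suc i)) e ⟩
        M (suc i) (suc p)                  ≈⟨ eq (suc i) ⟨
        M (suc i) (inject₁ p)              ≡⟨ ≡.cong (M (suc i)) e′ ⟨
        M (suc i) (punchIn (suc p) j)      ∎

    x = M zero (suc p) * minor (suc p)

    cancel : (- 1#) ^ toℕ (inject₁ p) * (M zero (inject₁ p) * minor (inject₁ p))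
             + (- 1#) ^ suc (toℕ p) * x ≈ 0#
    cancel = begin
      (- 1#) ^ toℕ (inject₁ p) * (M zero (inject₁ p) * minor (inject₁ p)) + (- 1#) ^ suc (toℕ p) * x
        ≈⟨ +-cong (*-cong (reflexive (≡.cong ((- 1#) ^_) (Fin.toℕ-inject₁ p)))
                          (*-cong (eq zero) minors-agree))
                  (*-assoc _ _ _) ⟩
      (- 1#) ^ toℕ p * x + - 1# * ((- 1#) ^ toℕ p * x)  ≈⟨ +-congˡ (-1*x≈-x _) ⟩
      (- 1#) ^ toℕ p * x - (- 1#) ^ toℕ p * x           ≈⟨ -‿inverseʳ _ ⟩
      0#                                                ∎

    vanish : ∀ j → j ≢ inject₁ p → j ≢ suc p → (- 1#) ^ toℕ j * (M zero j * minor j) ≈ 0#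
    vanish j j≢p j≢p⁺ with adjacent-punchIn p j j≢p j≢p⁺
    ... | p′ , e , e⁺ = begin
      (- 1#) ^ toℕ j * (M zero j * minor j)
        ≈⟨ *-congˡ (*-congˡ (det-adjacent-equal p′ (submatrix K zero j M) λ i →
             trans (reflexive (≡.cong (M (suc i)) e))
                   (trans (eq (suc i)) (reflexive (≡.cong (M (suc i)) (≡.sym e⁺)))))) ⟩
      (- 1#) ^ toℕ j * (M zero j * 0#)  ≈⟨ *-congˡ (zeroʳ _) ⟩
      (- 1#) ^ toℕ j * 0#               ≈⟨ zeroʳ _ ⟩
      0#                                ∎

  replaceColumn : ∀ {n} → Fin n → (Fin n → Carrier) → Matrix n → Matrix n
  replaceColumn q w M i = updateAt (M i) q (const (w i))

  replaceColumn-updates : ∀ {n} q w (M : Matrix n) i → replaceColumn q w M i q ≈ w i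
  replaceColumn-updates q w M i = reflexive (updateAt-updates q (M i))

  replaceColumn-minimal : ∀ {n} q w (M : Matrix n) i j → j ≢ q → replaceColumn q w M i j ≈ M i j
  replaceColumn-minimal q w M i j j≢q = reflexive (updateAt-minimal j q (M i) j≢q)

  replaceColumn-≈ : ∀ {n} q {w} {M N : Matrix n} → (∀ i → w i ≈ N i q) →
    (∀ i j → j ≢ q → M i j ≈ N i j) → ∀ i j → replaceColumn q w M i j ≈ N i j
  replaceColumn-≈ q {w} {M} at-q off-q i j with j Fin.≟ q
  ... | yes ≡.refl = trans (replaceColumn-updates q w M i) (at-q i)
  ... | no j≢q     = trans (replaceColumn-minimal q w M i j j≢q) (off-q i j j≢q)

  -- Induction on the number `k` of columns between `a` and `b`. With `u` and `v` the columns `b`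
  -- and `b⁻`, the matrix with `u + v` in both places has determinant 0 and splits by additivity.
  -- The part with `v` twice vanishes by adjacency, the part with `u` in column `b⁻` vanishes by
  -- induction because column `a` equals `u`, and only `M` is left.
  det-equal-columns-< : ∀ {n} k (a b : Fin n) (M : Matrix n) → toℕ b ≡ suc (k ℕ.+ toℕ a) →
    (∀ i → M i a ≈ M i b) → det K n M ≈ 0#
  det-equal-columns-< zero a (suc p) M b≡1+a eq =
    det-adjacent-equal p M λ i → trans (reflexive (≡.cong (M i) p≡a)) (eq i)
    where
    p≡a : inject₁ p ≡ a
    p≡a = Fin.toℕ-injective (≡.trans (Fin.toℕ-inject₁ p) (ℕ.suc-injective b≡1+a))
  det-equal-columns-< {suc n} (suc k) a (suc p) M b≡2+k+a eq = begin
    det K (suc n) M                       ≈⟨ +-identityʳ _ ⟨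
    det K (suc n) M + 0#                  ≈⟨ +-congˡ (det-adjacent-equal p M₁ M₁-equal) ⟨
    det K (suc n) M + det K (suc n) M₁    ≈⟨ det-additive (suc n) b M₂-sum M₂≈M M₂≈M₁ ⟨
    det K (suc n) M₂                      ≈⟨ +-identityʳ _ ⟨
    det K (suc n) M₂ + 0#                 ≈⟨ +-congˡ (det-equal-columns-< k a b⁻ M₃ b⁻≡1+k+a M₃-equal) ⟨
    det K (suc n) M₂ + det K (suc n) M₃   ≈⟨ det-additive (suc n) b⁻ M₄-sum M₄≈M₂ M₄≈M₃ ⟨
    det K (suc n) M₄                      ≈⟨ det-adjacent-equal p M₄ M₄-equal ⟩
    0#                                    ∎
    where
    b b⁻ : Fin (suc n)
    b  = suc p
    b⁻ = inject₁ p
    u v s : Fin (suc n) → Carrier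
    u i = M i b
    v i = M i b⁻
    s i = u i + v i
    M₁ M₂ M₃ M₄ : Matrix (suc n)
    M₁ = replaceColumn b v M
    M₂ = replaceColumn b s M
    M₃ = replaceColumn b⁻ u M₂
    M₄ = replaceColumn b⁻ s M₂
    b⁻≡1+k+a : toℕ b⁻ ≡ suc (k ℕ.+ toℕ a)
    b⁻≡1+k+a = ≡.trans (Fin.toℕ-inject₁ p) (ℕ.suc-injective b≡2+k+a)
    b⁻≢b : b⁻ ≢ b
    b⁻≢b e = ℕ.1+n≢n (≡.trans (≡.cong toℕ (≡.sym e)) (Fin.toℕ-inject₁ p))
    a≢b⁻ : a ≢ b⁻
    a≢b⁻ e = ℕ.m≢1+n+m (toℕ a) (≡.trans (≡.cong toℕ e) b⁻≡1+k+a)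
    a≢b : a ≢ b
    a≢b e = ℕ.m≢1+n+m (toℕ a) (≡.trans (≡.cong toℕ e) b≡2+k+a)
    M₁-equal : ∀ i → M₁ i b⁻ ≈ M₁ i b
    M₁-equal i = trans (replaceColumn-minimal b v M i b⁻ b⁻≢b)
                       (sym (replaceColumn-updates b v M i))
    M₂≈M : ∀ i j → j ≢ b → M₂ i j ≈ M i j
    M₂≈M i j = replaceColumn-minimal b s M i j
    M₂≈M₁ : ∀ i j → j ≢ b → M₂ i j ≈ M₁ i j
    M₂≈M₁ i j j≢b = trans (M₂≈M i j j≢b) (sym (replaceColumn-minimal b v M i j j≢b))
    M₂-sum : ∀ i → M₂ i b ≈ M i b + M₁ i b
    M₂-sum i = trans (replaceColumn-updates b s M i)
                     (+-congˡ (sym (replaceColumn-updates b v M i)))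
    M₃-equal : ∀ i → M₃ i a ≈ M₃ i b⁻
    M₃-equal i = begin
      M₃ i a   ≈⟨ replaceColumn-minimal b⁻ u M₂ i a a≢b⁻ ⟩
      M₂ i a   ≈⟨ M₂≈M i a a≢b ⟩
      M i a    ≈⟨ eq i ⟩
      M i b    ≈⟨ replaceColumn-updates b⁻ u M₂ i ⟨
      M₃ i b⁻  ∎
    M₄≈M₂ : ∀ i j → j ≢ b⁻ → M₄ i j ≈ M₂ i j
    M₄≈M₂ i j = replaceColumn-minimal b⁻ s M₂ i j
    M₄≈M₃ : ∀ i j → j ≢ b⁻ → M₄ i j ≈ M₃ i j
    M₄≈M₃ i j j≢b⁻ = trans (M₄≈M₂ i j j≢b⁻) (sym (replaceColumn-minimal b⁻ u M₂ i j j≢b⁻))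
    M₄-sum : ∀ i → M₄ i b⁻ ≈ M₂ i b⁻ + M₃ i b⁻
    M₄-sum i = begin
      M₄ i b⁻            ≈⟨ replaceColumn-updates b⁻ s M₂ i ⟩
      u i + v i          ≈⟨ +-comm _ _ ⟩
      v i + u i          ≈⟨ +-cong (M₂≈M i b⁻ b⁻≢b) (replaceColumn-updates b⁻ u M₂ i) ⟨
      M₂ i b⁻ + M₃ i b⁻  ∎
    M₄-equal : ∀ i → M₄ i b⁻ ≈ M₄ i b
    M₄-equal i = begin
      M₄ i b⁻    ≈⟨ replaceColumn-updates b⁻ s M₂ i ⟩
      u i + v i  ≈⟨ replaceColumn-updates b s M i ⟨
      M₂ i b     ≈⟨ M₄≈M₂ i b (b⁻≢b ∘ ≡.sym) ⟨
      M₄ i b     ∎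

  det-equal-columns : ∀ {n} (a b : Fin n) (M : Matrix n) → a ≢ b →
    (∀ i → M i a ≈ M i b) → det K n M ≈ 0#
  det-equal-columns a b M a≢b eq with Fin.<-cmp a b
  ... | tri< a<b _ _ = det-equal-columns-< _ a b M (m<n⇒n≡1+[n∸1+m]+m a<b) eq
  ... | tri≈ _ a≡b _ = contradiction a≡b a≢b
  ... | tri> _ _ b<a = det-equal-columns-< _ b a M (m<n⇒n≡1+[n∸1+m]+m b<a) (sym ∘ eq)

  det-column-sum : ∀ {n k} (q : Fin n) (M : Matrix n) (v : Fin k → Carrier) (u : Fin k → Fin n → Carrier) →
    det K n (replaceColumn q (λ i → ∑ K λ j → v j * u j i) M)
      ≈ ∑ K λ j → v j * det K n (replaceColumn q (u j) M)
  det-column-sum {n} {zero}  q M v u = det-zero-column n q (replaceColumn-updates q (const 0#) M)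
  det-column-sum {n} {suc k} q M v u = begin
    det K n (replaceColumn q whole M)
      ≈⟨ det-linear n q (v zero) 1#
           (λ i → trans (replaceColumn-updates q whole M i)
                    (sym (+-cong (*-congˡ (replaceColumn-updates q (u zero) M i))
                       (trans (*-identityˡ _) (replaceColumn-updates q rest M i)))))
           (λ i j j≢q → trans (replaceColumn-minimal q whole M i j j≢q)
                          (sym (replaceColumn-minimal q (u zero) M i j j≢q)))
           (λ i j j≢q → trans (replaceColumn-minimal q whole M i j j≢q)
                          (sym (replaceColumn-minimal q rest M i j j≢q))) ⟩
    v zero * det K n (replaceColumn q (u zero) M) + 1# * det K n (replaceColumn q rest M)
      ≈⟨ +-congˡ (trans (*-identityˡ _) (det-column-sum q M (v ∘ suc) (u ∘ suc))) ⟩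
    (∑ K λ j → v j * det K n (replaceColumn q (u j) M)) ∎
    where
    whole rest : Fin n → Carrier
    whole i = v zero * u zero i + rest i
    rest i = ∑ K λ j → v (suc j) * u (suc j) i

  -- Putting the combination `M v` into column `q` and expanding by linearity gives one determinant
  -- for each column of `M`. All of them except that of column `q` itself have a repeated column.
  cramer : ∀ {n} (q : Fin n) (M : Matrix n) (v w : Fin n → Carrier) →
    (∀ i → (∑ K λ j → M i j * v j) ≈ w i) →
    v q * det K n M ≈ det K n (replaceColumn q w M)
  cramer {n} q M v w Mv≈w = begin
    v q * det K n M
      ≈⟨ *-congˡ (det-cong n (replaceColumn-≈ q (λ _ → refl) λ _ _ _ → refl)) ⟨
    v q * det K n (replaceColumn q (λ i → M i q) M)
      ≈⟨ sum-single q (λ j → v j * det K n (replaceColumn q (λ i → M i j) M)) vanish ⟨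
    (∑ K λ j → v j * det K n (replaceColumn q (λ i → M i j) M))
      ≈⟨ det-column-sum q M v (λ j i → M i j) ⟨
    det K n (replaceColumn q (λ i → ∑ K λ j → v j * M i j) M)
      ≈⟨ det-cong n (replaceColumn-≈ q
           (λ i → trans (trans (sum-cong-≋ λ j → *-comm (v j) (M i j)) (Mv≈w i))
                        (sym (replaceColumn-updates q w M i)))
           (λ i j j≢q → sym (replaceColumn-minimal q w M i j j≢q))) ⟩
    det K n (replaceColumn q w M) ∎
    where
    vanish : ∀ j → j ≢ q → v j * det K n (replaceColumn q (λ i → M i j) M) ≈ 0#
    vanish j j≢q = trans (*-congˡ (det-equal-columns j q (replaceColumn q (λ i → M i j) M) j≢q λ i →
      trans (replaceColumn-minimal q (λ i → M i j) M i j j≢q) (sym (replaceColumn-updates q (λ i → M i j) M i)))) (zeroʳ _)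

  -- Cramer's rule for the square matrix obtained by putting a unit row on top of M.
  kernel-minors : ∀ n (M : Fin n → Fin (suc n) → Carrier) (v : Fin (suc n) → Carrier) →
    (∀ i → (∑ K λ j → M i j * v j) ≈ 0#) → v (fromℕ n) ≈ 1# → ∀ l →
    (- 1#) ^ toℕ l * det K n (λ i j → M i (punchIn l j))
      ≈ (- 1#) ^ n * (v l * det K n (λ i j → M i (punchIn (fromℕ n) j)))
  kernel-minors n M v Mv≈0 v≈1 l = begin
    (- 1#) ^ toℕ l * det K n (λ i j → M i (punchIn l j))
      ≈⟨ *-congˡ (trans (*-congʳ δ-diagonal) (*-identityˡ _)) ⟨
    term B l                              ≈⟨ sum-single l (term B) (λ j j≢l →
                                               trans (*-congˡ (trans (*-congʳ (δ-off j≢l)) (zeroˡ _))) (zeroʳ _)) ⟨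
    det K (suc n) B                       ≈⟨ trans (*-congʳ v≈1) (*-identityˡ _) ⟨
    v last * det K (suc n) B              ≈⟨ cramer last B v w Bv≈w ⟩
    det K (suc n) (replaceColumn last w B) ≈⟨ sum-single last (term B′) vanish ⟩
    term B′ last
      ≈⟨ *-cong (reflexive (≡.cong ((- 1#) ^_) (Fin.toℕ-fromℕ n)))
           (*-cong (replaceColumn-updates last w B zero)
              (det-cong n λ i j → replaceColumn-minimal last w B (suc i) (punchIn last j) (Fin.punchInᵢ≢i last j))) ⟩
    (- 1#) ^ n * (v l * det K n (λ i j → M i (punchIn last j))) ∎
    where
    last : Fin (suc n)
    last = fromℕ n
    δ : Fin (suc n) → Carrier
    δ j = if does (j Fin.≟ l) then 1# else 0#
    δ-diagonal : δ l ≈ 1#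
    δ-diagonal rewrite dec-true (l Fin.≟ l) ≡.refl = refl
    δ-off : ∀ {j} → j ≢ l → δ j ≈ 0#
    δ-off {j} j≢l rewrite dec-false (j Fin.≟ l) j≢l = refl
    B B′ : Matrix (suc n)
    B zero    = δ
    B (suc i) = M i
    -- `B` maps `v` to `w`. Once `w` is the last column, every minor of the first-row expansion that
    -- keeps this column contains a zero column.
    w : Fin (suc n) → Carrier
    w zero    = v l
    w (suc i) = 0#
    B′ = replaceColumn last w B
    term : Matrix (suc n) → Fin (suc n) → Carrier
    term A j = (- 1#) ^ toℕ j * (A zero j * det K n (submatrix K zero j A))
    Bv≈w : ∀ i → (∑ K λ j → B i j * v j) ≈ w i
    Bv≈w (suc i) = Mv≈0 i
    Bv≈w zero    = begin
      (∑ K λ j → δ j * v j)  ≈⟨ sum-single l (λ j → δ j * v j) (λ j j≢l → trans (*-congʳ (δ-off j≢l)) (zeroˡ _)) ⟩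
      δ l * v l              ≈⟨ trans (*-congʳ δ-diagonal) (*-identityˡ _) ⟩
      v l                    ∎
    vanish : ∀ j → j ≢ last → term B′ j ≈ 0#
    vanish j j≢last = trans (*-congˡ (trans (*-congˡ minor≈0) (zeroʳ _))) (zeroʳ _)
      where
      minor≈0 : det K n (submatrix K zero j B′) ≈ 0#
      minor≈0 = det-zero-column n (punchOut j≢last) λ i →
        trans (reflexive (≡.cong (B′ (suc i)) (Fin.punchIn-punchOut j≢last)))
              (replaceColumn-updates last w B (suc i))

  det-first-row : ∀ n {M : Matrix (suc n)} → (∀ j → M zero (suc j) ≈ 0#) →
    det K (suc n) M ≈ M zero zero * det K n (λ i j → M (suc i) (suc j))
  det-first-row n {M} row≈0 =
    trans (sum-single zero (λ j → (- 1#) ^ toℕ j * (M zero j * det K n (submatrix K zero j M))) vanish)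
          (*-identityˡ _)
    where
    vanish : ∀ j → j ≢ zero → (- 1#) ^ toℕ j * (M zero j * det K n (submatrix K zero j M)) ≈ 0#
    vanish zero    j≢0 = contradiction ≡.refl j≢0
    vanish (suc j) _   = trans (*-congˡ (trans (*-congʳ (row≈0 j)) (zeroˡ _))) (zeroʳ _)

  module _ {n : ℕ} (M : Matrix (suc n)) (κ : Fin n → Carrier) where

    -- The columns are modified from right to left, so that each one still has an
    -- unmodified left neighbour; k is the number of columns not yet modified.
    det-column-operations-from : ∀ d k → k ℕ.+ d ≡ suc n → (N : Matrix (suc n)) →
      (∀ i → N i zero ≈ M i zero) → (∀ i j → toℕ j ℕ.< k → N i j ≈ M i j) →
      (∀ i l → k ℕ.≤ suc (toℕ l) → N i (suc l) ≈ M i (suc l) + κ l * M i (inject₁ l)) →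
      det K (suc n) N ≈ det K (suc n) M
    det-column-operations-from zero k k≡1+n N first agree modified =
      det-cong (suc n) λ i j → agree i j
        (≡.subst (toℕ j ℕ.<_) (≡.trans (≡.sym k≡1+n) (ℕ.+-identityʳ k)) (Fin.toℕ<n j))
    -- The first column has no left neighbour and stays as in `M`, so `k = 0` amounts to `k = 1`.
    det-column-operations-from (suc d) zero d≡n N first agree modified =
      det-column-operations-from d 1 d≡n N first
        (λ { i zero _ → first i ; i (suc j) (ℕ.s≤s ()) }) (λ i l _ → modified i l ℕ.z≤n)
    det-column-operations-from (suc d) (suc k) k+d≡n N first agree modified = begin
      det K (suc n) N
        -- `q` is the leftmost modified column. Its two summands give `N₁`, in which it is restored,
        -- and `N₂`, in which it repeats its left neighbour.
        ≈⟨ det-linear (suc n) q 1# (κ l) at-q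
             (λ i j j≢q → sym (replaceColumn-minimal q u N i j j≢q))
             (λ i j j≢q → sym (replaceColumn-minimal q v N i j j≢q)) ⟩
      1# * det K (suc n) N₁ + κ l * det K (suc n) N₂
        ≈⟨ +-cong (*-identityˡ _) (trans (*-congˡ (det-adjacent-equal l N₂ N₂-equal)) (zeroʳ _)) ⟩
      det K (suc n) N₁ + 0#  ≈⟨ +-identityʳ _ ⟩
      det K (suc n) N₁
        ≈⟨ det-column-operations-from d (suc (suc k)) (≡.trans (≡.sym (ℕ.+-suc (suc k) d)) k+d≡n) N₁
             (λ i → trans (replaceColumn-minimal q u N i zero λ ()) (first i))
             agree₁ modified₁ ⟩
      det K (suc n) M ∎
      where
      k<n : k ℕ.< n
      k<n = ℕ.≤-trans (ℕ.m≤m+n (suc k) d)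
              (ℕ.≤-reflexive (ℕ.suc-injective (≡.trans (≡.sym (ℕ.+-suc (suc k) d)) k+d≡n)))
      l : Fin n
      l = Fin.fromℕ< k<n
      l≡k : toℕ l ≡ k
      l≡k = Fin.toℕ-fromℕ< k<n
      q : Fin (suc n)
      q = suc l
      u v : Fin (suc n) → Carrier
      u i = M i q
      v i = M i (inject₁ l)
      N₁ N₂ : Matrix (suc n)
      N₁ = replaceColumn q u N
      N₂ = replaceColumn q v N
      at-q : ∀ i → N i q ≈ 1# * N₁ i q + κ l * N₂ i q
      at-q i = trans (modified i l (ℕ.s≤s (ℕ.≤-reflexive (≡.sym l≡k))))
        (sym (+-cong (trans (*-identityˡ _) (replaceColumn-updates q u N i))
                     (*-congˡ (replaceColumn-updates q v N i))))
      inject₁l≤k : toℕ (inject₁ l) ℕ.< suc k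
      inject₁l≤k = ℕ.s≤s (ℕ.≤-reflexive (≡.trans (Fin.toℕ-inject₁ l) l≡k))
      inject₁l≢q : inject₁ l ≢ q
      inject₁l≢q e = ℕ.1+n≢n (≡.trans (≡.cong toℕ (≡.sym e)) (Fin.toℕ-inject₁ l))
      N₂-equal : ∀ i → N₂ i (inject₁ l) ≈ N₂ i q
      N₂-equal i = begin
        N₂ i (inject₁ l)  ≈⟨ replaceColumn-minimal q v N i (inject₁ l) inject₁l≢q ⟩
        N i (inject₁ l)   ≈⟨ agree i (inject₁ l) inject₁l≤k ⟩
        M i (inject₁ l)   ≈⟨ replaceColumn-updates q v N i ⟨
        N₂ i q            ∎
      agree₁ : ∀ i j → toℕ j ℕ.< suc (suc k) → N₁ i j ≈ M i j
      agree₁ i j j<2+k with j Fin.≟ q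
      ... | yes ≡.refl = replaceColumn-updates q u N i
      ... | no j≢q = trans (replaceColumn-minimal q u N i j j≢q)
        (agree i j (ℕ.≤∧≢⇒< (ℕ.s≤s⁻¹ j<2+k) λ j≡1+k →
          j≢q (Fin.toℕ-injective (≡.trans j≡1+k (≡.cong suc (≡.sym l≡k))))))
      modified₁ : ∀ i m → suc (suc k) ℕ.≤ suc (toℕ m) →
        N₁ i (suc m) ≈ M i (suc m) + κ m * M i (inject₁ m)
      modified₁ i m (ℕ.s≤s k<m) =
        trans (replaceColumn-minimal q u N i (suc m) λ { ≡.refl → ℕ.<-irrefl (≡.sym l≡k) k<m })
              (modified i m (ℕ.m≤n⇒m≤1+n k<m))

    det-column-operations : (N : Matrix (suc n)) → (∀ i → N i zero ≈ M i zero) →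
      (∀ i l → N i (suc l) ≈ M i (suc l) + κ l * M i (inject₁ l)) →
      det K (suc n) N ≈ det K (suc n) M
    det-column-operations N first modified =
      det-column-operations-from (suc n) 0 ≡.refl N first (λ _ _ ()) (λ i l _ → modified i l)

-- Hard configurations on G_r

-- In terms of zero-based positions, G_r joins consecutive vertices and
-- vertices of odd positions at distance two.
Link : ℕ → ℕ → Set
Link a b = b ≡ suc a ⊎ ∃ λ k → a ≡ suc (k ℕ.* 2) × b ≡ suc (suc k ℕ.* 2)

Link-shift : ∀ {a b} → Link (suc a) (suc b) → Link (3 ℕ.+ a) (3 ℕ.+ b)
Link-shift (inj₁ e) = inj₁ (≡.cong (2 ℕ.+_) e)
Link-shift (inj₂ (k , e , e′)) = inj₂ (suc k , ≡.cong (2 ℕ.+_) e , ≡.cong (2 ℕ.+_) e′)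

Link-unshift : ∀ {a b} → Link (3 ℕ.+ a) (3 ℕ.+ b) → Link (suc a) (suc b)
Link-unshift (inj₁ e) = inj₁ (≡.cong (ℕ._∸ 2) e)
Link-unshift (inj₂ (suc k , e , e′)) = inj₂ (k , ≡.cong (ℕ._∸ 2) e , ≡.cong (ℕ._∸ 2) e′)

Link⇒< : ∀ {a b} → Link a b → a ℕ.< b
Link⇒< (inj₁ ≡.refl) = ℕ.≤-refl
Link⇒< (inj₂ (k , ≡.refl , ≡.refl)) = ℕ.m≤n⇒m≤1+n ℕ.≤-refl

Link-0 : ∀ {b} → Link 0 b → b ≡ 1
Link-0 (inj₁ e) = e

Link-1 : ∀ {b} → Link 1 b → b ≡ 2 ⊎ b ≡ 3
Link-1 (inj₁ e) = inj₁ e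
Link-1 (inj₂ (zero , _ , e)) = inj₂ e

Link-2 : ∀ {b} → Link 2 b → b ≡ 3
Link-2 (inj₁ e) = e
Link-2 (inj₂ (zero , () , _))
Link-2 (inj₂ (suc k , () , _))

evenOdd evenEven oddEven : ℕ → List (ℕ × ℕ)
evenOdd  r = List.map (λ k → 2 ℕ.* k , 2 ℕ.* k ℕ.+ 1) (applyUpTo (1 ℕ.+_) r)
evenEven r = List.map (λ k → 2 ℕ.* k ℕ.∸ 2 , 2 ℕ.* k) (applyUpTo (2 ℕ.+_) (r ℕ.∸ 1))
oddEven  r = List.map (λ k → 2 ℕ.* k ℕ.∸ 1 , 2 ℕ.* k) (applyUpTo (2 ℕ.+_) (r ℕ.∸ 1))

edge⇒Link : ∀ r {a b} → (suc a , suc b) ∈ˡ edges r → Link a b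
edge⇒Link r (Any.here ≡.refl) = inj₁ ≡.refl
edge⇒Link r (Any.there e) with ∈-++⁻ (evenOdd r) e
... | inj₁ e₁ with ∈-map⁻ _ e₁
...   | k , _ , eq with ,-injective eq
...     | eqa , eqb = inj₁ (ℕ.suc-injective (≡.trans eqb (≡.trans (ℕ.+-comm _ 1) (≡.cong suc (≡.sym eqa)))))
edge⇒Link r (Any.there e) | inj₂ e₂ with ∈-++⁻ (evenEven r) e₂
... | inj₁ e₃ with ∈-map⁻ _ e₃
...   | k , k∈ , eq with ∈-applyUpTo⁻ (2 ℕ.+_) k∈ | ,-injective eq
...     | i , _ , ≡.refl | eqa , eqb = inj₂ (i
            , ℕ.suc-injective (≡.trans eqa (≡.cong (ℕ._∸ 2) (ℕ.*-comm 2 (2 ℕ.+ i))))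
            , ℕ.suc-injective (≡.trans eqb (ℕ.*-comm 2 (2 ℕ.+ i))))
edge⇒Link r (Any.there e) | inj₂ e₂ | inj₂ e₄ with ∈-map⁻ _ e₄
... | k , k∈ , eq with ∈-applyUpTo⁻ (2 ℕ.+_) k∈ | ,-injective eq
...   | i , _ , ≡.refl | eqa , eqb =
            inj₁ (ℕ.suc-injective (≡.trans eqb (≡.cong suc (≡.sym eqa))))

data Parity : ℕ → Set where
  even : ∀ k → Parity (k ℕ.* 2)
  odd  : ∀ k → Parity (suc (k ℕ.* 2))

parityOf : ∀ n → Parity n
parityOf zero = even 0
parityOf (suc n) with parityOf n
... | even k = odd k
... | odd k  = even (suc k)

-- For consecutive positions the parity of the zero-based `a` selects the list: odd positions carry
-- even labels and lead to `evenOdd`, positive even positions lead to `oddEven`, and position 0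
-- gives the exceptional edge (1 , 2).
Link⇒edge : ∀ r {a b} → b ℕ.< suc (r ℕ.* 2) → Link a b → (suc a , suc b) ∈ˡ edges r
Link⇒edge r b<r l = from l b<r
  where
  double : ∀ k → 2 ℕ.* k ≡ k ℕ.* 2
  double = ℕ.*-comm 2
  bound : ∀ r k → suc (suc k ℕ.* 2) ℕ.< suc (r ℕ.* 2) → k ℕ.< r ℕ.∸ 1
  bound (suc r) k (ℕ.s≤s b<) = ℕ.s≤s⁻¹ (ℕ.*-cancelʳ-< 2 (suc k) (suc r) b<)
  consecutive : ∀ {a} → Parity a → suc a ℕ.< suc (r ℕ.* 2) → (suc a , suc (suc a)) ∈ˡ edges r
  consecutive (even zero) b< = Any.here ≡.refl
  consecutive (even (suc k)) b< = Any.there (∈-++⁺ʳ (evenOdd r) (∈-++⁺ʳ (evenEven r)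
    (≡.subst (_∈ˡ oddEven r) (≡.cong₂ _,_ (≡.cong (ℕ._∸ 1) (double (2 ℕ.+ k))) (double (2 ℕ.+ k)))
      (∈-map⁺ _ (∈-applyUpTo⁺ (2 ℕ.+_) (bound r k b<))))))
  consecutive (odd k) b< = Any.there (∈-++⁺ˡ
    (≡.subst (_∈ˡ evenOdd r) (≡.cong₂ _,_ (double (suc k)) (≡.trans (ℕ.+-comm _ 1) (≡.cong suc (double (suc k)))))
      (∈-map⁺ _ (∈-applyUpTo⁺ (1 ℕ.+_) (ℕ.*-cancelʳ-≤ (suc k) r 2 (ℕ.s≤s⁻¹ b<))))))
  from : ∀ {a b} → Link a b → b ℕ.< suc (r ℕ.* 2) → (suc a , suc b) ∈ˡ edges r
  from {a} (inj₁ ≡.refl) b< = consecutive (parityOf a) b<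
  from (inj₂ (k , ≡.refl , ≡.refl)) b< = Any.there (∈-++⁺ʳ (evenOdd r) (∈-++⁺ˡ
    (≡.subst (_∈ˡ evenEven r) (≡.cong₂ _,_ (≡.cong (ℕ._∸ 2) (double (2 ℕ.+ k))) (double (2 ℕ.+ k)))
      (∈-map⁺ _ (∈-applyUpTo⁺ (2 ℕ.+_) (bound r k b<))))))

Separated : ∀ {n} → Subset n → Set
Separated C = ∀ u v → u ∈ C → v ∈ C → ¬ Link (toℕ u) (toℕ v)

-- The vertices are read in the pairs (2k, 2k+1); the flag tells whether the
-- previous pair is occupied, which is all that matters for the vertex 2k.
spaced : ∀ r → Bool → Subset (r ℕ.* 2) → Bool
spaced zero    f []          = true
spaced (suc r) f (e ∷ o ∷ C) = not (e ∧ (f ∨ o)) ∧ spaced r (e ∨ o) C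

-- Both vertices of a pair are joined to the vertex that follows the pair and to nothing beyond it.
-- They can be merged into one vertex, which takes the place of the first vertex of a shorter graph.
Separated-tail : ∀ {n} c e o {C : Subset n} → Separated (c ∷ e ∷ o ∷ C) → Separated ((e ∨ o) ∷ C)
Separated-tail c e o s zero zero _ _ l = ℕ.n≮0 (Link⇒< l)
Separated-tail c true o s zero (suc zero) here (there v∈) _ =
  s (suc zero) (suc (suc (suc zero))) (there here) (there (there (there v∈))) (inj₂ (0 , ≡.refl , ≡.refl))
Separated-tail c false true s zero (suc zero) here (there v∈) _ =
  s (suc (suc zero)) (suc (suc (suc zero))) (there (there here)) (there (there (there v∈))) (inj₁ ≡.refl)
Separated-tail c e o s zero (suc (suc v)) _ _ l with Link-0 l
... | ()
Separated-tail c e o s (suc u) zero _ _ l = ℕ.n≮0 (Link⇒< l)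
Separated-tail c e o s (suc u) (suc v) (there u∈) (there v∈) l =
  s (suc (suc (suc u))) (suc (suc (suc v))) (there (there (there u∈))) (there (there (there v∈))) (Link-shift l)

Separated⇒spaced : ∀ r c (C : Subset (r ℕ.* 2)) → Separated (c ∷ C) → T (spaced r c C)
Separated⇒spaced zero    c []          s = _
Separated⇒spaced (suc r) true  (true  ∷ o     ∷ C) s =
  contradiction (inj₁ ≡.refl) (s zero (suc zero) here (there here))
Separated⇒spaced (suc r) false (true  ∷ true  ∷ C) s =
  contradiction (inj₁ ≡.refl) (s (suc zero) (suc (suc zero)) (there here) (there (there here)))
Separated⇒spaced (suc r) false (true  ∷ false ∷ C) s =
  Separated⇒spaced r true C (Separated-tail false true false s)
Separated⇒spaced (suc r) c     (false ∷ o     ∷ C) s =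
  Separated⇒spaced r o C (Separated-tail c false o s)

spaced⇒Separated : ∀ r c (C : Subset (r ℕ.* 2)) → T (spaced r c C) → Separated (c ∷ C)
spaced⇒Separated r c C p zero zero _ _ l = ℕ.n≮0 (Link⇒< l)
spaced⇒Separated r c C p (suc u) zero _ _ l = ℕ.n≮0 (Link⇒< l)
spaced⇒Separated (suc r) c (e ∷ o ∷ C) p zero (suc (suc v)) _ _ l with Link-0 l
... | ()
spaced⇒Separated (suc r) true (true ∷ o ∷ C) () zero (suc zero) here (there here) l
spaced⇒Separated (suc r) c C p (suc u) (suc zero) _ _ l = ℕ.n≮0 (ℕ.s≤s⁻¹ (Link⇒< l))
spaced⇒Separated (suc r) c C p (suc (suc u)) (suc (suc zero)) _ _ l = ℕ.n≮0 (ℕ.s≤s⁻¹ (ℕ.s≤s⁻¹ (Link⇒< l)))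
spaced⇒Separated (suc r) true (true ∷ true ∷ C) () (suc zero) (suc (suc zero)) (there here) (there (there here)) l
spaced⇒Separated (suc r) false (true ∷ true ∷ C) () (suc zero) (suc (suc zero)) (there here) (there (there here)) l
spaced⇒Separated (suc r) c (true ∷ o ∷ C) p (suc zero) (suc (suc (suc v))) (there here) (there (there (there v∈))) l
  with Link-1 l
... | inj₂ 3+v≡3 = spaced⇒Separated r true C (proj₂ (Equivalence.to (T-∧ {not (c ∨ o)}) p)) zero (suc v) here (there v∈)
                     (inj₁ (≡.cong (ℕ._∸ 2) 3+v≡3))
spaced⇒Separated (suc r) c (e ∷ true ∷ C) p (suc (suc zero)) (suc (suc (suc v))) (there (there here)) (there (there (there v∈))) l =
  spaced⇒Separated r (e ∨ true) C (proj₂ (Equivalence.to (T-∧ {not (e ∧ (c ∨ true))}) p)) zero (suc v)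
    (≡.subst (λ b → zero ∈ (b ∷ C)) (≡.sym (∨-zeroʳ e)) here) (there v∈)
    (inj₁ (≡.cong (ℕ._∸ 2) (Link-2 l)))
spaced⇒Separated (suc r) c (e ∷ o ∷ C) p (suc (suc (suc u))) (suc (suc (suc v))) (there (there (there u∈))) (there (there (there v∈))) l =
  spaced⇒Separated r (e ∨ o) C (proj₂ (Equivalence.to (T-∧ {not (e ∧ (c ∨ o))}) p)) (suc u) (suc v)
    (there u∈) (there v∈) (Link-unshift l)

-- Replaces the test over all pairs of vertices by a reading from left to right, with the first
-- vertex as the initial flag; in this form the sum over configurations can be split pair by pair.
isHard?-spaced : ∀ r c (C : Subset (r ℕ.* 2)) →
  does (isHard? (Adjacent r) (adjacent? r) (c ∷ C)) ≡ spaced r c C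
isHard?-spaced r c C = does-⇔ (mk⇔
  (λ hard → Separated⇒spaced r c C λ u v u∈ v∈ l → hard u v u∈ v∈ (Link⇒edge r (Fin.toℕ<n v) l))
  (λ sp u v u∈ v∈ e → spaced⇒Separated r c C sp u v u∈ v∈ (edge⇒Link r e)))
  (isHard? (Adjacent r) (adjacent? r) (c ∷ C)) (T? (spaced r c C))

evenVertex oddVertex : ∀ {r} → Fin r → Fin (r ℕ.* 2)
evenVertex zero    = zero
evenVertex (suc i) = suc (suc (evenVertex i))
oddVertex zero    = suc zero
oddVertex (suc i) = suc (suc (oddVertex i))

-- Generating functions of the hard configurations.

module PartitionFunction {c ℓ₁ ℓ₂} (K : HeytingField c ℓ₁ ℓ₂) where

  open HeytingCommutativeRing (HeytingField.heytingCommutativeRing K) using (commutativeRing)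
  open CommutativeRing commutativeRing hiding (zero)
  open SemiringSolver commutativeSemiring using (solve; _:+_; _:*_; _:=_)
  open SetoidReasoning setoid

  private
    variable
      x : Level
      X : Set x

  listSum : List Carrier → Carrier
  listSum = List.foldr _+_ 0#

  listSum-++ : ∀ xs ys → listSum (xs List.++ ys) ≈ listSum xs + listSum ys
  listSum-++ []       ys = sym (+-identityˡ _)
  listSum-++ (x ∷ xs) ys = trans (+-congˡ (listSum-++ xs ys)) (sym (+-assoc _ _ _))

  listSum-cong : {f g : X → Carrier} → (∀ x → f x ≈ g x) → ∀ xs →
    listSum (List.map f xs) ≈ listSum (List.map g xs)
  listSum-cong f≈g []       = refl
  listSum-cong f≈g (x ∷ xs) = +-cong (f≈g x) (listSum-cong f≈g xs)

  listSum-linear : (b d : Carrier) (f g : X → Carrier) → ∀ xs →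
    listSum (List.map (λ x → b * f x + d * g x) xs)
      ≈ b * listSum (List.map f xs) + d * listSum (List.map g xs)
  listSum-linear b d f g []       = sym (trans (+-cong (zeroʳ _) (zeroʳ _)) (+-identityʳ _))
  listSum-linear b d f g (x ∷ xs) = trans (+-congˡ (listSum-linear b d f g xs))
    (solve 6 (λ b d x y s t → (b :* x :+ d :* y) :+ (b :* s :+ d :* t)
                           := b :* (x :+ s) :+ d :* (y :+ t)) refl
       b d (f x) (g x) _ _)

  listSum-filter : ∀ {p} {P : Pred X p} (P? : Decidable P) (f : X → Carrier) → ∀ xs →
    listSum (List.map f (filter P? xs)) ≈ listSum (List.map (λ x → if does (P? x) then f x else 0#) xs)
  listSum-filter P? f []       = refl
  listSum-filter P? f (x ∷ xs) with does (P? x)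
  ... | true  = +-congˡ (listSum-filter P? f xs)
  ... | false = trans (listSum-filter P? f xs) (sym (+-identityˡ _))

  sumSubsets : ∀ n → (Subset n → Carrier) → Carrier
  sumSubsets n g = listSum (List.map g (subsets n))

  sumSubsets-suc : ∀ n (g : Subset (suc n) → Carrier) →
    sumSubsets (suc n) g ≈ sumSubsets n (λ C → g (inside ∷ C)) + sumSubsets n (λ C → g (outside ∷ C))
  sumSubsets-suc n g = begin
    listSum (List.map g (List.map (inside ∷_) (subsets n) List.++ List.map (outside ∷_) (subsets n)))
      ≡⟨ ≡.cong listSum (List.map-++ g (List.map (inside ∷_) (subsets n)) _) ⟩
    listSum (List.map g (List.map (inside ∷_) (subsets n)) List.++ List.map g (List.map (outside ∷_) (subsets n)))
      ≈⟨ listSum-++ (List.map g (List.map (inside ∷_) (subsets n))) _ ⟩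
    listSum (List.map g (List.map (inside ∷_) (subsets n))) + listSum (List.map g (List.map (outside ∷_) (subsets n)))
      ≡⟨ ≡.cong₂ (λ xs ys → listSum xs + listSum ys) (List.map-∘ (subsets n)) (List.map-∘ (subsets n)) ⟨
    sumSubsets n (λ C → g (inside ∷ C)) + sumSubsets n (λ C → g (outside ∷ C)) ∎

  sumSubsets-cong : ∀ n {f g : Subset n → Carrier} → (∀ C → f C ≈ g C) → sumSubsets n f ≈ sumSubsets n g
  sumSubsets-cong n f≈g = listSum-cong f≈g (subsets n)

  sumSubsets-scale : ∀ n b (f : Subset n → Carrier) →
    sumSubsets n (λ C → b * f C) ≈ b * sumSubsets n f
  sumSubsets-scale n b f = begin
    sumSubsets n (λ C → b * f C)
      ≈⟨ sumSubsets-cong n (λ C → trans (sym (+-identityʳ _)) (+-congˡ (sym (zeroˡ _)))) ⟩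
    sumSubsets n (λ C → b * f C + 0# * f C)    ≈⟨ listSum-linear b 0# f f (subsets n) ⟩
    b * sumSubsets n f + 0# * sumSubsets n f   ≈⟨ trans (+-congˡ (zeroˡ _)) (+-identityʳ _) ⟩
    b * sumSubsets n f                         ∎

  -- A polynomial is represented by its sequence of coefficients.
  shift : (ℕ → Carrier) → ℕ → Carrier
  shift s zero    = 0#
  shift s (suc j) = s j

  shiftBy : ℕ → (ℕ → Carrier) → ℕ → Carrier
  shiftBy zero    s = s
  shiftBy (suc m) s = shift (shiftBy m s)

  shiftBy-shift : ∀ m s j → shift (shiftBy m s) j ≡ shiftBy m (shift s) j
  shiftBy-shift zero    s j       = ≡.refl
  shiftBy-shift (suc m) s zero    = ≡.refl
  shiftBy-shift (suc m) s (suc j) = shiftBy-shift m s j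

  shift-linear : ∀ {b d} {s t u : ℕ → Carrier} → (∀ j → u j ≈ b * s j + d * t j) →
    ∀ j → shift u j ≈ b * shift s j + d * shift t j
  shift-linear eq zero    = sym (trans (+-cong (zeroʳ _) (zeroʳ _)) (+-identityʳ _))
  shift-linear eq (suc j) = eq j

  shiftBy-linear : ∀ m {b d} {s t u : ℕ → Carrier} → (∀ j → u j ≈ b * s j + d * t j) →
    ∀ j → shiftBy m u j ≈ b * shiftBy m s j + d * shiftBy m t j
  shiftBy-linear zero    eq = eq
  shiftBy-linear (suc m) eq = shift-linear (shiftBy-linear m eq)

  one : ℕ → Carrier
  one zero    = 1#
  one (suc j) = 0#

  -- Turns the restriction to cardinality `j` into the coefficient of a monomial, so that the sum
  -- over configurations can carry an arbitrary polynomial as a further factor.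
  shiftBy-one : ∀ m j → shiftBy m one j ≡ (if m ≡ᵇ j then 1# else 0#)
  shiftBy-one zero    zero    = ≡.refl
  shiftBy-one zero    (suc j) = ≡.refl
  shiftBy-one (suc m) zero    = ≡.refl
  shiftBy-one (suc m) (suc j) = shiftBy-one m j

  -- The product of the polynomial s and the generating function of the hard
  -- configurations on the last 2r vertices, at the coefficient j.
  spacedSum : ∀ r → Bool → (Fin (r ℕ.* 2) → Carrier) → (ℕ → Carrier) → ℕ → Carrier
  spacedSum r f y s j = sumSubsets (r ℕ.* 2) λ C →
    if spaced r f C then configurationWeight K y C * shiftBy ∣ C ∣ s j else 0#

  spacedSum-linear : ∀ r f y {b d} {s t u : ℕ → Carrier} → (∀ j → u j ≈ b * s j + d * t j) →
    ∀ j → spacedSum r f y u j ≈ b * spacedSum r f y s j + d * spacedSum r f y t j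
  spacedSum-linear r f y {b} {d} {s} {t} {u} eq j =
    trans (sumSubsets-cong (r ℕ.* 2) summand)
          (listSum-linear b d _ _ (subsets (r ℕ.* 2)))
    where
    summand : ∀ C →
      (if spaced r f C then configurationWeight K y C * shiftBy ∣ C ∣ u j else 0#)
      ≈ b * (if spaced r f C then configurationWeight K y C * shiftBy ∣ C ∣ s j else 0#)
      + d * (if spaced r f C then configurationWeight K y C * shiftBy ∣ C ∣ t j else 0#)
    summand C with spaced r f C
    ... | false = sym (trans (+-cong (zeroʳ _) (zeroʳ _)) (+-identityʳ _))
    ... | true  = trans (*-congˡ (shiftBy-linear ∣ C ∣ eq j))
      (solve 5 (λ w b d x y → w :* (b :* x :+ d :* y) := b :* (w :* x) :+ d :* (w :* y)) refl
        (configurationWeight K y C) b d (shiftBy ∣ C ∣ s j) (shiftBy ∣ C ∣ t j))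

  if-scale : ∀ b {x a z} → x ≈ a * z → (if b then x else 0#) ≈ a * (if b then z else 0#)
  if-scale true  eq = eq
  if-scale false eq = sym (zeroʳ _)

  if-cong : ∀ b {x z} → x ≈ z → (if b then x else 0#) ≈ (if b then z else 0#)
  if-cong true  eq = eq
  if-cong false eq = refl

  module _ r (y : Fin (suc r ℕ.* 2) → Carrier) (s : ℕ → Carrier) (j : ℕ) where

    private
      n = r ℕ.* 2
      y″ : Fin n → Carrier
      y″ i = y (suc (suc i))
      term : Bool → Subset (suc (suc n)) → Carrier
      term f C = if spaced (suc r) f C then configurationWeight K y C * shiftBy ∣ C ∣ s j else 0#

      split : ∀ f → spacedSum (suc r) f y s j ≈
        (sumSubsets n (λ C → term f (inside ∷ inside ∷ C)) + sumSubsets n (λ C → term f (inside ∷ outside ∷ C)))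
        + (sumSubsets n (λ C → term f (outside ∷ inside ∷ C)) + sumSubsets n (λ C → term f (outside ∷ outside ∷ C)))
      split f = trans (sumSubsets-suc (suc n) (term f))
        (+-cong (sumSubsets-suc n (λ C → term f (inside ∷ C))) (sumSubsets-suc n (λ C → term f (outside ∷ C))))

      sum-zeros : sumSubsets n (λ _ → 0#) ≈ 0#
      sum-zeros = trans (sumSubsets-cong n (λ _ → sym (zeroˡ 0#)))
        (trans (sumSubsets-scale n 0# (λ _ → 0#)) (zeroˡ _))

      evenTerm : sumSubsets n (λ C → term false (inside ∷ outside ∷ C))
        ≈ y zero * spacedSum r true y″ (shift s) j
      evenTerm = trans (sumSubsets-cong n λ C → if-scale (spaced r true C)
          (trans (*-cong (*-congˡ (*-identityˡ _)) (reflexive (shiftBy-shift ∣ C ∣ s j))) (*-assoc _ _ _)))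
        (sumSubsets-scale n (y zero) _)

      oddTerm : ∀ f → sumSubsets n (λ C → term f (outside ∷ inside ∷ C))
        ≈ y (suc zero) * spacedSum r true y″ (shift s) j
      oddTerm f = trans (sumSubsets-cong n λ C → if-scale (spaced r true C)
          (trans (*-cong (*-identityˡ _) (reflexive (shiftBy-shift ∣ C ∣ s j))) (*-assoc _ _ _)))
        (sumSubsets-scale n (y (suc zero)) _)

      emptyTerm : ∀ f → sumSubsets n (λ C → term f (outside ∷ outside ∷ C)) ≈ spacedSum r false y″ s j
      emptyTerm f = sumSubsets-cong n λ C → if-cong (spaced r false C)
        (*-congʳ (trans (*-identityˡ _) (*-identityˡ _)))

    -- A doubly occupied pair contributes nothing, and either vertex alone leaves the same flag to
    -- the pairs that follow, so the two weights add up.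
    spacedSum-suc-false : spacedSum (suc r) false y s j ≈
      spacedSum r false y″ s j + (y (suc zero) + y zero) * spacedSum r true y″ (shift s) j
    spacedSum-suc-false = begin
      spacedSum (suc r) false y s j  ≈⟨ split false ⟩
      _  ≈⟨ +-cong (+-cong sum-zeros evenTerm) (+-cong (oddTerm false) (emptyTerm false)) ⟩
      (0# + y zero * S₁) + (y (suc zero) * S₁ + S₀)  ≈⟨ +-congʳ (+-identityˡ _) ⟩
      y zero * S₁ + (y (suc zero) * S₁ + S₀)
        ≈⟨ solve 4 (λ e o u v → e :* u :+ (o :* u :+ v) := v :+ (o :+ e) :* u) refl
             (y zero) (y (suc zero)) S₁ S₀ ⟩
      S₀ + (y (suc zero) + y zero) * S₁ ∎
      where
      S₀ = spacedSum r false y″ s j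
      S₁ = spacedSum r true y″ (shift s) j

    spacedSum-suc-true : spacedSum (suc r) true y s j ≈
      spacedSum r false y″ s j + y (suc zero) * spacedSum r true y″ (shift s) j
    spacedSum-suc-true = begin
      spacedSum (suc r) true y s j  ≈⟨ split true ⟩
      _  ≈⟨ +-cong (+-cong sum-zeros sum-zeros) (+-cong (oddTerm true) (emptyTerm true)) ⟩
      (0# + 0#) + (y (suc zero) * S₁ + S₀)  ≈⟨ +-congʳ (+-identityˡ _) ⟩
      0# + (y (suc zero) * S₁ + S₀)         ≈⟨ +-identityˡ _ ⟩
      y (suc zero) * S₁ + S₀                ≈⟨ +-comm _ _ ⟩
      S₀ + y (suc zero) * S₁ ∎
      where
      S₀ = spacedSum r false y″ s j
      S₁ = spacedSum r true y″ (shift s) j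

  -- Generating functions of the hard configurations on the first vertices:
  -- F (m + 2) is that of G_m, for the weights ye m of the vertices 2m and
  -- yo m of the vertices 2m + 1.
  module _ (ye yo : ℕ → Carrier) where

    F : ℕ → ℕ → Carrier
    F zero          j = 0#
    F (suc zero)    j = one j
    F (suc (suc m)) j = F (suc m) j + (yo m * shift (F (suc m)) j + ye m * shift (F m) j)

    -- The increment of `F`: the configurations on G_m that occupy 2m or 2m + 1. An occupied 2m also
    -- excludes 2m - 1 and 2m - 2, which is why it comes with `F m` and not with `F (suc m)`.
    G : ℕ → ℕ → Carrier
    G m j = yo m * shift (F (suc m)) j + ye m * shift (F m) j

    F-constant : ∀ m → F (suc m) 0 ≈ 1#
    F-constant zero    = refl
    F-constant (suc m) = begin
      F (suc m) 0 + (yo m * 0# + ye m * 0#)  ≈⟨ +-cong (F-constant m) (+-cong (zeroʳ _) (zeroʳ _)) ⟩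
      1# + (0# + 0#)                         ≈⟨ trans (+-congˡ (+-identityʳ _)) (+-identityʳ _) ⟩
      1#                                     ∎

    -- Sums over `Subset` unfold from the first vertex, whereas `F` grows at the last one. The
    -- invariant joining the two keeps the vertices already read as a polynomial factor: `F (suc m)`
    -- if their last pair is empty, which sets the flag to `false`, and `G m` if it is occupied.
    -- Reading one more pair passes from `m` to `suc m`.
    spacedSum-F : ∀ r m (y : Fin (r ℕ.* 2) → Carrier) →
      (∀ (i : Fin r) → y (evenVertex i) ≈ ye (suc m ℕ.+ toℕ i)) → (∀ (i : Fin r) → y (oddVertex i) ≈ yo (suc m ℕ.+ toℕ i)) →
      ∀ j → spacedSum r false y (F (suc m)) j + spacedSum r true y (G m) j ≈ F (r ℕ.+ suc (suc m)) j
    spacedSum-F zero m y _ _ j = +-cong (single (F (suc m))) (single (G m))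
      where
      single : ∀ s → 1# * s j + 0# ≈ s j
      single s = trans (+-identityʳ _) (*-identityˡ _)
    spacedSum-F (suc r) m y y-even y-odd j = begin
      spacedSum (suc r) false y A j + spacedSum (suc r) true y B j
        ≈⟨ +-cong (spacedSum-suc-false r y A j) (spacedSum-suc-true r y B j) ⟩
      (S₀ A + (o + e) * S₁ (shift A)) + (S₀ B + o * S₁ (shift B))
        ≈⟨ solve 6 (λ a b c d o e → (a :+ (o :+ e) :* c) :+ (b :+ o :* d)
             := (a :+ b) :+ (o :* (c :+ d) :+ e :* c)) refl
             (S₀ A) (S₀ B) (S₁ (shift A)) (S₁ (shift B)) o e ⟩
      (S₀ A + S₀ B) + (o * (S₁ (shift A) + S₁ (shift B)) + e * S₁ (shift A))
        ≈⟨ +-cong (S-sum false (λ _ → refl))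
             (+-cong (*-cong o≈ (S-sum true (shift-sum A B))) (*-congʳ e≈)) ⟩
      S₀ (F (2 ℕ.+ m)) + (yo (suc m) * S₁ (shift (F (2 ℕ.+ m))) + ye (suc m) * S₁ (shift A))
        ≈⟨ +-congˡ (spacedSum-linear r true y″ (λ _ → refl) j) ⟨
      S₀ (F (2 ℕ.+ m)) + S₁ (G (suc m))
        ≈⟨ spacedSum-F r (suc m) y″
             (λ i → trans (y-even (suc i)) (reflexive (≡.cong (ye ∘ suc) (ℕ.+-suc m (toℕ i)))))
             (λ i → trans (y-odd (suc i)) (reflexive (≡.cong (yo ∘ suc) (ℕ.+-suc m (toℕ i))))) j ⟩
      F (r ℕ.+ suc (suc (suc m))) j  ≡⟨ ≡.cong (λ k → F k j) (ℕ.+-suc r (suc (suc m))) ⟩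
      F (suc r ℕ.+ suc (suc m)) j ∎
      where
      A = F (suc m)
      B = G m
      e = y zero
      o = y (suc zero)
      e≈ : e ≈ ye (suc m)
      e≈ = trans (y-even zero) (reflexive (≡.cong (ye ∘ suc) (ℕ.+-identityʳ m)))
      o≈ : o ≈ yo (suc m)
      o≈ = trans (y-odd zero) (reflexive (≡.cong (yo ∘ suc) (ℕ.+-identityʳ m)))
      y″ : Fin (r ℕ.* 2) → Carrier
      y″ i = y (suc (suc i))
      S₀ S₁ : (ℕ → Carrier) → Carrier
      S₀ s = spacedSum r false y″ s j
      S₁ s = spacedSum r true y″ s j
      1*+1* : ∀ x z → x + z ≈ 1# * x + 1# * z
      1*+1* x z = sym (+-cong (*-identityˡ x) (*-identityˡ z))
      shift-sum : ∀ s t k → shift (λ k → s k + t k) k ≈ shift s k + shift t k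
      shift-sum s t zero    = sym (+-identityʳ _)
      shift-sum s t (suc k) = refl
      S-sum : ∀ f {s t u} → (∀ k → u k ≈ s k + t k) →
        spacedSum r f y″ s j + spacedSum r f y″ t j ≈ spacedSum r f y″ u j
      S-sum f eq = trans (1*+1* _ _)
        (sym (spacedSum-linear r f y″ (λ k → trans (eq k) (1*+1* _ _)) j))

    Z-F : ∀ r (y : Vertex r → Carrier) → y zero ≈ yo 0 →
      (∀ (i : Fin r) → y (suc (evenVertex i)) ≈ ye (suc (toℕ i))) → (∀ (i : Fin r) → y (suc (oddVertex i)) ≈ yo (suc (toℕ i))) →
      ∀ j → Z K r j y ≈ F (r ℕ.+ 2) j
    Z-F r y y-first y-even y-odd j = begin
      Z K r j y
        ≈⟨ listSum-filter _ (configurationWeight K y) (subsets (suc (r ℕ.* 2))) ⟩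
      sumSubsets (suc (r ℕ.* 2)) term
        ≈⟨ sumSubsets-suc (r ℕ.* 2) term ⟩
      sumSubsets (r ℕ.* 2) (λ C → term (inside ∷ C)) + sumSubsets (r ℕ.* 2) (λ C → term (outside ∷ C))
        ≈⟨ +-cong (trans (sumSubsets-cong (r ℕ.* 2) insideTerm) (sumSubsets-scale (r ℕ.* 2) (y zero) _))
                  (sumSubsets-cong (r ℕ.* 2) outsideTerm) ⟩
      y zero * spacedSum r true y′ (shift one) j + spacedSum r false y′ one j
        ≈⟨ +-comm _ _ ⟩
      spacedSum r false y′ one j + y zero * spacedSum r true y′ (shift one) j
        ≈⟨ +-congˡ (trans (+-congʳ (*-congʳ (sym y-first))) (trans (+-congˡ (zeroˡ _)) (+-identityʳ _))) ⟨
      -- The zero summand matches the part `ye 0 * shift (F 0)` of `G 0`, as `F 0` is zero.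
      spacedSum r false y′ one j + (yo 0 * spacedSum r true y′ (shift one) j + 0# * spacedSum r true y′ (shift one) j)
        ≈⟨ +-congˡ (spacedSum-linear r true y′ (λ k → +-congˡ (trans (*-congˡ (shift-zero k)) (trans (zeroʳ _) (sym (zeroˡ _))))) j) ⟨
      spacedSum r false y′ (F 1) j + spacedSum r true y′ (G 0) j
        ≈⟨ spacedSum-F r 0 y′ y-even y-odd j ⟩
      F (r ℕ.+ 2) j ∎
      where
      y′ : Fin (r ℕ.* 2) → Carrier
      y′ i = y (suc i)
      term : Subset (suc (r ℕ.* 2)) → Carrier
      term C = if does (isHard? (Adjacent r) (adjacent? r) C) ∧ (∣ C ∣ ≡ᵇ j) then configurationWeight K y C else 0#
      shift-zero : ∀ k → shift (λ _ → 0#) k ≈ 0#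
      shift-zero zero    = refl
      shift-zero (suc k) = refl
      if-∧ : ∀ b d x → (if b ∧ d then x else 0#) ≈ (if b then x * (if d then 1# else 0#) else 0#)
      if-∧ true  true  x = sym (*-identityʳ x)
      if-∧ true  false x = sym (zeroʳ x)
      if-∧ false d     x = refl
      outsideTerm : ∀ C → term (outside ∷ C) ≈
        (if spaced r false C then configurationWeight K y′ C * shiftBy ∣ C ∣ one j else 0#)
      outsideTerm C rewrite isHard?-spaced r outside C | shiftBy-one ∣ C ∣ j =
        trans (if-∧ (spaced r false C) _ _) (if-cong (spaced r false C) (*-congʳ (*-identityˡ _)))
      insideTerm : ∀ C → term (inside ∷ C) ≈
        y zero * (if spaced r true C then configurationWeight K y′ C * shiftBy ∣ C ∣ (shift one) j else 0#)
      insideTerm C rewrite isHard?-spaced r inside C | ≡.sym (shiftBy-shift ∣ C ∣ one j) | shiftBy-one (suc ∣ C ∣) j =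
        trans (if-∧ (spaced r true C) _ _) (if-scale (spaced r true C) (*-assoc _ _ _))

-- The Q-system

+-+-assoc : ∀ n a b → n ℤ.+ + a ℤ.+ + b ≡ n ℤ.+ + (a ℕ.+ b)
+-+-assoc n a b = ℤ.+-assoc n (+ a) (+ b)

+-suc-pred : ∀ n a → n ℤ.+ + suc a ℤ.- 1ℤ ≡ n ℤ.+ + a
+-suc-pred n a = ℤ.+-assoc n (+ suc a) -1ℤ

toℕ-punchIn-last : ∀ {m} (j : Fin m) → toℕ (punchIn (fromℕ m) j) ≡ toℕ j
toℕ-punchIn-last zero    = ≡.refl
toℕ-punchIn-last (suc j) = ≡.cong suc (toℕ-punchIn-last j)

module _ {c ℓ₁ ℓ₂} (K : HeytingField c ℓ₁ ℓ₂) where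

  open HeytingCommutativeRing (HeytingField.heytingCommutativeRing K) using (commutativeRing)
  open CommutativeRing commutativeRing hiding (zero)
  open RawSemiringOps (Semiring.rawSemiring semiring) using (_^_)
  open CommutativeMonoidSum +-commutativeMonoid using (sum-cong-≋; ∑-distrib-+; sum-permute)
  open SemiringSum semiring using (*-distribˡ-sum)
  open SemiringExp semiring using (^-homo-*)
  open RingProperties ring using (-1*x≈-x; -‿distribˡ-*; -‿distribʳ-*; -‿involutive; -0#≈0#)
  open AbelianGroupProperties +-abelianGroup using () renaming (⁻¹-∙-comm to -‿+-comm)
  open SemiringSolver commutativeSemiring using (solve; _:+_; _:*_; _:=_)
  open SetoidReasoning setoid
  open Determinant K
  open PartitionFunction K

  *-unitʳ : ∀ {x u} → u ≈ 1# → x * u ≈ x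
  *-unitʳ u≈1 = trans (*-congˡ u≈1) (*-identityʳ _)

  x+-y≈z : ∀ {x y z} → x ≈ z + y → x - y ≈ z
  x+-y≈z {x} {y} {z} x≈z+y = begin
    x - y        ≈⟨ +-congʳ x≈z+y ⟩
    z + y - y    ≈⟨ +-assoc z y (- y) ⟩
    z + (y - y)  ≈⟨ +-congˡ (-‿inverseʳ y) ⟩
    z + 0#       ≈⟨ +-identityʳ z ⟩
    z            ∎

  -x*-y≈x*y : ∀ x y → - x * - y ≈ x * y
  -x*-y≈x*y x y = trans (sym (-‿distribˡ-* x (- y)))
    (trans (-‿cong (sym (-‿distribʳ-* x y))) (-‿involutive _))

  constant-on-ℤ : (f : ℤ → Carrier) → (∀ n → f (n ℤ.+ 1ℤ) ≈ f n) → ∀ m n → f m ≈ f n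
  constant-on-ℤ f step m n = trans (to-0 m) (sym (to-0 n))
    where
    to-0 : ∀ n → f n ≈ f 0ℤ
    to-0 (+ zero)      = refl
    to-0 (+ suc k)     = trans (reflexive (≡.cong (f ∘ +_) (ℕ.+-comm 1 k))) (trans (step (+ k)) (to-0 (+ k)))
    to-0 -[1+ zero ]   = sym (step -[1+ 0 ])
    to-0 -[1+ suc k ]  = trans (sym (step -[1+ suc k ])) (to-0 -[1+ k ])

  -- σ (m + 1) is R_m; the conventions σ 0 = R_{-1} = 0 and σ (r + 3) = R_{r+2} = 0
  -- make the Q-system relation hold for m = 0 and m = r + 1 as well.
  module QSystem (r : ℕ) (σ τ : ℕ → ℤ → Carrier)
    (σ-bottom : ∀ n → σ 0 n ≈ 0#) (σ-one : ∀ n → σ 1 n ≈ 1#)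
    (σ-last : ∀ n → σ (2 ℕ.+ r) n ≈ 1#) (σ-top : ∀ n → σ (3 ℕ.+ r) n ≈ 0#)
    (σ-τ : ∀ m → m ℕ.≤ suc r → ∀ n → σ (suc m) n * τ (suc m) n ≈ 1#)
    (σ-relation : ∀ m → m ℕ.≤ suc r → ∀ n →
      σ (suc m) (n ℤ.+ 1ℤ ℤ.+ 1ℤ) * σ (suc m) n
        ≈ σ (suc m) (n ℤ.+ 1ℤ) * σ (suc m) (n ℤ.+ 1ℤ) + σ (2 ℕ.+ m) (n ℤ.+ 1ℤ) * σ m (n ℤ.+ 1ℤ))
    where

    -- With `σ (suc m)` for R_m and `τ` for its inverse, `ye m` is y_{2m} and `yo m` is y_{2m+1}.
    -- The ratio `yl m` is where the weights of two times meet: it equals y_{2m+1} + y_{2m} at n + 1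
    -- and also y_{2m+1} + y_{2m+2} at n.
    ye yo yl : ℕ → ℤ → Carrier
    ye m n = σ m n * σ (2 ℕ.+ m) (n ℤ.+ 1ℤ) * (τ (1 ℕ.+ m) n * τ (1 ℕ.+ m) (n ℤ.+ 1ℤ))
    yo m n = σ (1 ℕ.+ m) n * σ (2 ℕ.+ m) (n ℤ.+ 1ℤ) * (τ (2 ℕ.+ m) n * τ (1 ℕ.+ m) (n ℤ.+ 1ℤ))
    yl m n = σ (2 ℕ.+ m) (n ℤ.+ 1ℤ ℤ.+ 1ℤ) * σ (1 ℕ.+ m) n
             * (τ (2 ℕ.+ m) (n ℤ.+ 1ℤ) * τ (1 ℕ.+ m) (n ℤ.+ 1ℤ))

    -- Over a common denominator the numerator becomes the right-hand side of the relation for R_m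
    -- centred at n + 1.
    yo+ye-next : ∀ m → m ℕ.≤ r → ∀ n → yo m (n ℤ.+ 1ℤ) + ye m (n ℤ.+ 1ℤ) ≈ yl m n
    yo+ye-next m m≤r n = begin
      s₁ * s₂″ * (i₂ * i₁″) + s₀ * s₂″ * (i₁ * i₁″)
        ≈⟨ +-cong (*-unitʳ (σ-τ m (ℕ.m≤n⇒m≤1+n m≤r) n⁺)) (*-unitʳ (σ-τ (suc m) (ℕ.s≤s m≤r) n⁺)) ⟨
      s₁ * s₂″ * (i₂ * i₁″) * (s₁ * i₁) + s₀ * s₂″ * (i₁ * i₁″) * (s₂ * i₂)
        ≈⟨ solve 7 (λ s₀ s₁ s₂ s₂″ i₁ i₂ i₁″ →
             s₁ :* s₂″ :* (i₂ :* i₁″) :* (s₁ :* i₁) :+ s₀ :* s₂″ :* (i₁ :* i₁″) :* (s₂ :* i₂)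
             := (s₁ :* s₁ :+ s₂ :* s₀) :* (s₂″ :* i₁ :* i₂ :* i₁″)) refl s₀ s₁ s₂ s₂″ i₁ i₂ i₁″ ⟩
      (s₁ * s₁ + s₂ * s₀) * (s₂″ * i₁ * i₂ * i₁″)
        ≈⟨ *-congʳ (σ-relation m (ℕ.m≤n⇒m≤1+n m≤r) n) ⟨
      s₁″ * s₁⁰ * (s₂″ * i₁ * i₂ * i₁″)
        ≈⟨ solve 6 (λ s₁⁰ s₁″ s₂″ i₁ i₂ i₁″ → s₁″ :* s₁⁰ :* (s₂″ :* i₁ :* i₂ :* i₁″)
             := s₂″ :* s₁⁰ :* (i₂ :* i₁) :* (s₁″ :* i₁″)) refl s₁⁰ s₁″ s₂″ i₁ i₂ i₁″ ⟩
      yl m n * (s₁″ * i₁″)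
        ≈⟨ *-unitʳ (σ-τ m (ℕ.m≤n⇒m≤1+n m≤r) (n⁺ ℤ.+ 1ℤ)) ⟩
      yl m n ∎
      where
      n⁺ = n ℤ.+ 1ℤ
      s₁⁰ = σ (1 ℕ.+ m) n
      s₀ = σ m n⁺
      s₁ = σ (1 ℕ.+ m) n⁺
      s₂ = σ (2 ℕ.+ m) n⁺
      s₁″ = σ (1 ℕ.+ m) (n⁺ ℤ.+ 1ℤ)
      s₂″ = σ (2 ℕ.+ m) (n⁺ ℤ.+ 1ℤ)
      i₁ = τ (1 ℕ.+ m) n⁺
      i₂ = τ (2 ℕ.+ m) n⁺
      i₁″ = τ (1 ℕ.+ m) (n⁺ ℤ.+ 1ℤ)

    -- Here the relation is that for R_{m+1}; for `m = r` it is the conventional one at the top.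
    yo+ye-suc : ∀ m → m ℕ.≤ r → ∀ n → yo m n + ye (suc m) n ≈ yl m n
    yo+ye-suc m m≤r n = begin
      s₁⁰ * s₂ * (i₂⁰ * i₁) + s₁⁰ * s₃ * (i₂⁰ * i₂)
        ≈⟨ +-cong (*-unitʳ (σ-τ (suc m) (ℕ.s≤s m≤r) n⁺)) (*-unitʳ (σ-τ m (ℕ.m≤n⇒m≤1+n m≤r) n⁺)) ⟨
      s₁⁰ * s₂ * (i₂⁰ * i₁) * (s₂ * i₂) + s₁⁰ * s₃ * (i₂⁰ * i₂) * (s₁ * i₁)
        ≈⟨ solve 7 (λ s₁⁰ s₁ s₂ s₃ i₂⁰ i₁ i₂ →
             s₁⁰ :* s₂ :* (i₂⁰ :* i₁) :* (s₂ :* i₂) :+ s₁⁰ :* s₃ :* (i₂⁰ :* i₂) :* (s₁ :* i₁)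
             := (s₂ :* s₂ :+ s₃ :* s₁) :* (s₁⁰ :* i₂⁰ :* i₁ :* i₂)) refl s₁⁰ s₁ s₂ s₃ i₂⁰ i₁ i₂ ⟩
      (s₂ * s₂ + s₃ * s₁) * (s₁⁰ * i₂⁰ * i₁ * i₂)
        ≈⟨ *-congʳ (σ-relation (suc m) (ℕ.s≤s m≤r) n) ⟨
      s₂″ * s₂⁰ * (s₁⁰ * i₂⁰ * i₁ * i₂)
        ≈⟨ solve 6 (λ s₁⁰ s₂⁰ s₂″ i₂⁰ i₁ i₂ → s₂″ :* s₂⁰ :* (s₁⁰ :* i₂⁰ :* i₁ :* i₂)
             := s₂″ :* s₁⁰ :* (i₂ :* i₁) :* (s₂⁰ :* i₂⁰)) refl s₁⁰ s₂⁰ s₂″ i₂⁰ i₁ i₂ ⟩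
      yl m n * (s₂⁰ * i₂⁰)
        ≈⟨ *-unitʳ (σ-τ (suc m) (ℕ.s≤s m≤r) n) ⟩
      yl m n ∎
      where
      n⁺ = n ℤ.+ 1ℤ
      s₁⁰ = σ (1 ℕ.+ m) n
      s₂⁰ = σ (2 ℕ.+ m) n
      s₁ = σ (1 ℕ.+ m) n⁺
      s₂ = σ (2 ℕ.+ m) n⁺
      s₃ = σ (3 ℕ.+ m) n⁺
      s₂″ = σ (2 ℕ.+ m) (n⁺ ℤ.+ 1ℤ)
      i₂⁰ = τ (2 ℕ.+ m) n
      i₁ = τ (1 ℕ.+ m) n⁺
      i₂ = τ (2 ℕ.+ m) n⁺

    -- Pure cancellation: both sides are R_{m+2,n+2} R_{m,n} / (R_{m+1,n+2} R_{m+1,n}).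
    ye-yo-exchange : ∀ m → suc m ℕ.≤ r → ∀ n →
      ye (suc m) (n ℤ.+ 1ℤ) * yo m n ≈ yo (suc m) (n ℤ.+ 1ℤ) * ye (suc m) n
    ye-yo-exchange m m<r n = begin
      s₁ * s₃″ * (i₂ * i₂″) * (s₁⁰ * s₂ * (i₂⁰ * i₁))
        ≈⟨ solve 8 (λ s₁ s₃″ i₂ i₂″ s₁⁰ s₂ i₂⁰ i₁ →
             s₁ :* s₃″ :* (i₂ :* i₂″) :* (s₁⁰ :* s₂ :* (i₂⁰ :* i₁))
             := s₃″ :* i₂″ :* s₁⁰ :* i₂⁰ :* (s₁ :* i₁) :* (s₂ :* i₂)) refl s₁ s₃″ i₂ i₂″ s₁⁰ s₂ i₂⁰ i₁ ⟩
      s₃″ * i₂″ * s₁⁰ * i₂⁰ * (s₁ * i₁) * (s₂ * i₂)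
        ≈⟨ trans (*-unitʳ (σ-τ (suc m) (ℕ.m≤n⇒m≤1+n m<r) n⁺)) (*-unitʳ (σ-τ m (ℕ.<⇒≤ (ℕ.m≤n⇒m≤1+n m<r)) n⁺)) ⟩
      s₃″ * i₂″ * s₁⁰ * i₂⁰
        ≈⟨ trans (*-unitʳ (σ-τ (2 ℕ.+ m) (ℕ.s≤s m<r) n⁺)) (*-unitʳ (σ-τ (suc m) (ℕ.m≤n⇒m≤1+n m<r) n⁺)) ⟨
      s₃″ * i₂″ * s₁⁰ * i₂⁰ * (s₂ * i₂) * (s₃ * i₃)
        ≈⟨ solve 8 (λ s₃″ i₂″ s₁⁰ i₂⁰ s₂ i₂ s₃ i₃ →
             s₃″ :* i₂″ :* s₁⁰ :* i₂⁰ :* (s₂ :* i₂) :* (s₃ :* i₃)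
             := s₂ :* s₃″ :* (i₃ :* i₂″) :* (s₁⁰ :* s₃ :* (i₂⁰ :* i₂))) refl s₃″ i₂″ s₁⁰ i₂⁰ s₂ i₂ s₃ i₃ ⟩
      s₂ * s₃″ * (i₃ * i₂″) * (s₁⁰ * s₃ * (i₂⁰ * i₂)) ∎
      where
      n⁺ = n ℤ.+ 1ℤ
      s₁⁰ = σ (1 ℕ.+ m) n
      s₁ = σ (1 ℕ.+ m) n⁺
      s₂ = σ (2 ℕ.+ m) n⁺
      s₃ = σ (3 ℕ.+ m) n⁺
      s₃″ = σ (3 ℕ.+ m) (n⁺ ℤ.+ 1ℤ)
      i₂⁰ = τ (2 ℕ.+ m) n
      i₁ = τ (1 ℕ.+ m) n⁺
      i₂ = τ (2 ℕ.+ m) n⁺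
      i₃ = τ (3 ℕ.+ m) n⁺
      i₂″ = τ (2 ℕ.+ m) (n⁺ ℤ.+ 1ℤ)

    ye-0 : ∀ n → ye 0 n ≈ 0#
    ye-0 n = trans (*-congʳ (trans (*-congʳ (σ-bottom n)) (zeroˡ _))) (zeroˡ _)

    ye-top : ∀ n → ye (suc r) n ≈ 0#
    ye-top n = trans (*-congʳ (trans (*-congˡ (σ-top _)) (zeroʳ _))) (zeroˡ _)

    -- The minus sign of t is absorbed into the weights, so that the recursions for `q` consist of
    -- sums and products only and fall to the semiring solver.
    we wo wl : ℕ → ℤ → Carrier
    we m n = - ye m n
    wo m n = - yo m n
    wl m n = - yl m n

    -- q m n is the generating function F m for the weights at n, with the variable
    -- acting on the sequence R_1 as minus the backward shift.
    q : ℕ → ℤ → ℤ → Carrier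
    q zero          n k = 0#
    q (suc zero)    n k = σ 2 k
    q (suc (suc m)) n k = q (suc m) n k + (wo m n * q (suc m) n (k ℤ.- 1ℤ) + we m n * q m n (k ℤ.- 1ℤ))

    we-0 : ∀ n → we 0 n ≈ 0#
    we-0 n = trans (-‿cong (ye-0 n)) -0#≈0#

    wo+we-next : ∀ m → m ℕ.≤ r → ∀ n → wo m (n ℤ.+ 1ℤ) + we m (n ℤ.+ 1ℤ) ≈ wl m n
    wo+we-next m m≤r n = trans (-‿+-comm _ _) (-‿cong (yo+ye-next m m≤r n))

    wo+we-suc : ∀ m → m ℕ.≤ r → ∀ n → wo m n + we (suc m) n ≈ wl m n
    wo+we-suc m m≤r n = trans (-‿+-comm _ _) (-‿cong (yo+ye-suc m m≤r n))

    we-wo-exchange : ∀ m → suc m ℕ.≤ r → ∀ n →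
      we (suc m) (n ℤ.+ 1ℤ) * wo m n ≈ wo (suc m) (n ℤ.+ 1ℤ) * we (suc m) n
    we-wo-exchange m m<r n = trans (-x*-y≈x*y _ _) (trans (ye-yo-exchange m m<r n) (sym (-x*-y≈x*y _ _)))

    mutual
      -- Three statements climb together. The defining recursion turns `q-next` into `q-suc` at the
      -- same level. At `suc m`, `q-next` comes from `q-suc-next` at `m` by splitting `wl m n` into
      -- weights at n, and `q-suc-next` comes from `q-next` at `suc m` and `q-suc` at `m` by the
      -- exchange relation.
      q-next : ∀ m → m ℕ.≤ suc r → ∀ n k →
        q (suc m) (n ℤ.+ 1ℤ) k ≈ q (suc m) n k + we m n * q m n (k ℤ.- 1ℤ)
      q-next zero    _           n k = sym (trans (+-congˡ (zeroʳ _)) (+-identityʳ _))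
      q-next (suc m) (ℕ.s≤s m≤r) n k = begin
        q (2 ℕ.+ m) (n ℤ.+ 1ℤ) k                     ≈⟨ q-suc-next m m≤r n k ⟩
        q (suc m) (n ℤ.+ 1ℤ) k + wl m n * Q          ≈⟨ +-congˡ (*-congʳ (wo+we-suc m m≤r n)) ⟨
        q (suc m) (n ℤ.+ 1ℤ) k + (wo m n + we (suc m) n) * Q
          ≈⟨ solve 4 (λ p o e x → p :+ (o :+ e) :* x := (p :+ o :* x) :+ e :* x) refl
               (q (suc m) (n ℤ.+ 1ℤ) k) (wo m n) (we (suc m) n) Q ⟩
        q (suc m) (n ℤ.+ 1ℤ) k + wo m n * Q + we (suc m) n * Q
          ≈⟨ +-congʳ (q-suc m (ℕ.m≤n⇒m≤1+n m≤r) n k) ⟨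
        q (2 ℕ.+ m) n k + we (suc m) n * Q           ∎
        where
        Q = q (suc m) n (k ℤ.- 1ℤ)

      q-suc : ∀ m → m ℕ.≤ suc r → ∀ n k →
        q (2 ℕ.+ m) n k ≈ q (suc m) (n ℤ.+ 1ℤ) k + wo m n * q (suc m) n (k ℤ.- 1ℤ)
      q-suc m m≤1+r n k = begin
        q (suc m) n k + (wo m n * Q + we m n * P)
          ≈⟨ solve 3 (λ p x z → p :+ (x :+ z) := (p :+ z) :+ x) refl
               (q (suc m) n k) (wo m n * Q) (we m n * P) ⟩
        q (suc m) n k + we m n * P + wo m n * Q    ≈⟨ +-congʳ (q-next m m≤1+r n k) ⟨
        q (suc m) (n ℤ.+ 1ℤ) k + wo m n * Q        ∎
        where
        Q = q (suc m) n (k ℤ.- 1ℤ)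
        P = q m n (k ℤ.- 1ℤ)

      q-suc-next : ∀ m → m ℕ.≤ r → ∀ n k →
        q (2 ℕ.+ m) (n ℤ.+ 1ℤ) k ≈ q (suc m) (n ℤ.+ 1ℤ) k + wl m n * q (suc m) n (k ℤ.- 1ℤ)
      q-suc-next zero m≤r n k = +-congˡ (begin
        wo 0 n⁺ * Q + we 0 n⁺ * 0#    ≈⟨ +-congˡ (trans (zeroʳ _) (sym (trans (*-congʳ (we-0 n⁺)) (zeroˡ Q)))) ⟩
        wo 0 n⁺ * Q + we 0 n⁺ * Q     ≈⟨ distribʳ Q _ _ ⟨
        (wo 0 n⁺ + we 0 n⁺) * Q       ≈⟨ *-congʳ (wo+we-next 0 m≤r n) ⟩
        wl 0 n * Q                    ∎)
        where
        n⁺ = n ℤ.+ 1ℤ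
        Q = σ 2 (k ℤ.- 1ℤ)
      q-suc-next (suc m) m<r n k = +-congˡ (begin
        o′ * q (2 ℕ.+ m) n⁺ k⁻ + e′ * P′
          ≈⟨ +-congʳ (*-congˡ (q-next (suc m) (ℕ.m≤n⇒m≤1+n m<r) n k⁻)) ⟩
        o′ * (Q + e * P) + e′ * P′
          ≈⟨ solve 6 (λ o′ Q e P e′ P′ → o′ :* (Q :+ e :* P) :+ e′ :* P′
               := o′ :* Q :+ ((o′ :* e) :* P :+ e′ :* P′)) refl o′ Q e P e′ P′ ⟩
        o′ * Q + (o′ * e * P + e′ * P′)
          -- The exchange trades the coefficients of `P`, so that `P′` and `P` occur in the
          -- combination that `q-suc` identifies with `Q`.
          ≈⟨ +-congˡ (+-congʳ (*-congʳ (we-wo-exchange m m<r n))) ⟨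
        o′ * Q + (e′ * o * P + e′ * P′)
          ≈⟨ solve 6 (λ o′ Q o P e′ P′ → o′ :* Q :+ (e′ :* o :* P :+ e′ :* P′)
               := o′ :* Q :+ e′ :* (P′ :+ o :* P)) refl o′ Q o P e′ P′ ⟩
        o′ * Q + e′ * (P′ + o * P)
          ≈⟨ +-congˡ (*-congˡ (q-suc m (ℕ.<⇒≤ (ℕ.m≤n⇒m≤1+n m<r)) n k⁻)) ⟨
        o′ * Q + e′ * Q              ≈⟨ distribʳ Q _ _ ⟨
        (o′ + e′) * Q                ≈⟨ *-congʳ (wo+we-next (suc m) m<r n) ⟩
        wl (suc m) n * Q             ∎)
        where
        n⁺ = n ℤ.+ 1ℤ
        k⁻ = k ℤ.- 1ℤ
        o′ = wo (suc m) n⁺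
        e′ = we (suc m) n⁺
        o = wo m n
        e = we (suc m) n
        Q = q (2 ℕ.+ m) n k⁻
        P′ = q (suc m) n⁺ k⁻
        P = q (suc m) n (k⁻ ℤ.- 1ℤ)

    -- In the step, `q-suc` yields a difference of two known quotients, which the relation for
    -- R_{m+1} reduces to R_{m+2,n+1} / R_{m+1,n}.
    q-leading : ∀ m → m ℕ.≤ suc r → ∀ n →
      q (suc m) n (n ℤ.+ + suc m) ≈ σ (2 ℕ.+ m) (n ℤ.+ 1ℤ) * τ (suc m) n
    q-leading zero m≤1+r n = begin
      σ 2 (n ℤ.+ 1ℤ)                      ≈⟨ *-unitʳ (σ-τ 0 m≤1+r n) ⟨
      σ 2 (n ℤ.+ 1ℤ) * (σ 1 n * τ 1 n)    ≈⟨ *-congˡ (trans (*-congʳ (σ-one n)) (*-identityˡ _)) ⟩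
      σ 2 (n ℤ.+ 1ℤ) * τ 1 n              ∎
    q-leading (suc m) (ℕ.s≤s m≤r) n = begin
      q (2 ℕ.+ m) n k                                   ≈⟨ q-suc m m≤1+r n k ⟩
      q (suc m) n⁺ k + wo m n * q (suc m) n (k ℤ.- 1ℤ)
        ≡⟨ ≡.cong₂ (λ k k′ → q (suc m) n⁺ k + wo m n * q (suc m) n k′)
             (≡.sym (+-+-assoc n 1 (suc m))) (+-suc-pred n (suc m)) ⟩
      q (suc m) n⁺ (n⁺ ℤ.+ + suc m) + wo m n * q (suc m) n (n ℤ.+ + suc m)
        ≈⟨ +-cong (q-leading m m≤1+r n⁺) (*-congˡ (q-leading m m≤1+r n)) ⟩
      s₂″ * i₁ + wo m n * (s₂ * i₁⁰)                     ≈⟨ +-congˡ (-‿distribˡ-* _ _) ⟨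
      s₂″ * i₁ - yo m n * (s₂ * i₁⁰)                     ≈⟨ x+-y≈z key ⟩
      s₃ * i₂⁰ ∎
      where
      n⁺ = n ℤ.+ 1ℤ
      k = n ℤ.+ + suc (suc m)
      m≤1+r = ℕ.m≤n⇒m≤1+n m≤r
      s₁⁰ = σ (1 ℕ.+ m) n
      s₂⁰ = σ (2 ℕ.+ m) n
      s₁ = σ (1 ℕ.+ m) n⁺
      s₂ = σ (2 ℕ.+ m) n⁺
      s₃ = σ (3 ℕ.+ m) n⁺
      s₂″ = σ (2 ℕ.+ m) (n⁺ ℤ.+ 1ℤ)
      i₁⁰ = τ (1 ℕ.+ m) n
      i₂⁰ = τ (2 ℕ.+ m) n
      i₁ = τ (1 ℕ.+ m) n⁺
      key : s₂″ * i₁ ≈ s₃ * i₂⁰ + yo m n * (s₂ * i₁⁰)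
      key = begin
        s₂″ * i₁                                 ≈⟨ *-unitʳ (σ-τ (suc m) (ℕ.s≤s m≤r) n) ⟨
        s₂″ * i₁ * (s₂⁰ * i₂⁰)
          ≈⟨ solve 4 (λ s i s⁰ i⁰ → s :* i :* (s⁰ :* i⁰) := s :* s⁰ :* (i :* i⁰)) refl s₂″ i₁ s₂⁰ i₂⁰ ⟩
        s₂″ * s₂⁰ * (i₁ * i₂⁰)                   ≈⟨ *-congʳ (σ-relation (suc m) (ℕ.s≤s m≤r) n) ⟩
        (s₂ * s₂ + s₃ * s₁) * (i₁ * i₂⁰)
          ≈⟨ solve 5 (λ s₁ s₂ s₃ i₁ i₂⁰ → (s₂ :* s₂ :+ s₃ :* s₁) :* (i₁ :* i₂⁰)
               := s₃ :* i₂⁰ :* (s₁ :* i₁) :+ s₂ :* s₂ :* (i₂⁰ :* i₁)) refl s₁ s₂ s₃ i₁ i₂⁰ ⟩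
        s₃ * i₂⁰ * (s₁ * i₁) + s₂ * s₂ * (i₂⁰ * i₁)
          ≈⟨ +-cong (*-unitʳ (σ-τ m m≤1+r n⁺)) (sym (*-unitʳ (σ-τ m m≤1+r n))) ⟩
        s₃ * i₂⁰ + s₂ * s₂ * (i₂⁰ * i₁) * (s₁⁰ * i₁⁰)
          ≈⟨ +-congˡ (solve 5 (λ s₂ i₂⁰ i₁ s₁⁰ i₁⁰ → s₂ :* s₂ :* (i₂⁰ :* i₁) :* (s₁⁰ :* i₁⁰)
               := s₁⁰ :* s₂ :* (i₂⁰ :* i₁) :* (s₂ :* i₁⁰)) refl s₂ i₂⁰ i₁ s₁⁰ i₁⁰) ⟩
        s₃ * i₂⁰ + yo m n * (s₂ * i₁⁰) ∎

    -- By `q-suc-next` this is a difference of two leading values, the second multiplied by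
    -- `yl m n`, which is exactly their ratio. The zero lies one index before the leading value of
    -- the same level and time.
    q-vanishes : ∀ m → m ℕ.≤ r → ∀ n → q (2 ℕ.+ m) (n ℤ.+ 1ℤ) (n ℤ.+ 1ℤ ℤ.+ + suc m) ≈ 0#
    q-vanishes m m≤r n = begin
      q (2 ℕ.+ m) n⁺ k                                   ≈⟨ q-suc-next m m≤r n k ⟩
      q (suc m) n⁺ k + wl m n * q (suc m) n (k ℤ.- 1ℤ)
        ≡⟨ ≡.cong (λ k′ → q (suc m) n⁺ k + wl m n * q (suc m) n k′)
             (≡.trans (≡.cong (ℤ._- 1ℤ) (+-+-assoc n 1 (suc m))) (+-suc-pred n (suc m))) ⟩
      q (suc m) n⁺ k + wl m n * q (suc m) n (n ℤ.+ + suc m)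
        ≈⟨ +-cong (q-leading m m≤1+r n⁺) (*-congˡ (q-leading m m≤1+r n)) ⟩
      s₂″ * i₁ + wl m n * (s₂ * i₁⁰)                     ≈⟨ +-congˡ (-‿distribˡ-* _ _) ⟨
      s₂″ * i₁ - yl m n * (s₂ * i₁⁰)                     ≈⟨ x+-y≈z (trans (sym key) (sym (+-identityˡ _))) ⟩
      0# ∎
      where
      n⁺ = n ℤ.+ 1ℤ
      k = n⁺ ℤ.+ + suc m
      m≤1+r = ℕ.m≤n⇒m≤1+n m≤r
      s₁⁰ = σ (1 ℕ.+ m) n
      s₂ = σ (2 ℕ.+ m) n⁺
      s₂″ = σ (2 ℕ.+ m) (n⁺ ℤ.+ 1ℤ)
      i₁⁰ = τ (1 ℕ.+ m) n
      i₁ = τ (1 ℕ.+ m) n⁺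
      i₂ = τ (2 ℕ.+ m) n⁺
      key : yl m n * (s₂ * i₁⁰) ≈ s₂″ * i₁
      key = begin
        s₂″ * s₁⁰ * (i₂ * i₁) * (s₂ * i₁⁰)
          ≈⟨ solve 6 (λ s₂″ s₁⁰ i₂ i₁ s₂ i₁⁰ → s₂″ :* s₁⁰ :* (i₂ :* i₁) :* (s₂ :* i₁⁰)
               := s₂″ :* i₁ :* (s₁⁰ :* i₁⁰) :* (s₂ :* i₂)) refl s₂″ s₁⁰ i₂ i₁ s₂ i₁⁰ ⟩
        s₂″ * i₁ * (s₁⁰ * i₁⁰) * (s₂ * i₂)
          ≈⟨ trans (*-unitʳ (σ-τ (suc m) (ℕ.s≤s m≤r) n⁺)) (*-unitʳ (σ-τ m m≤1+r n)) ⟩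
        s₂″ * i₁ ∎

    -- `q-vanishes` gives one zero for each time. As `ye (suc r)` is zero, `q-next` makes the top
    -- level independent of the time, which can then be chosen to suit `k`.
    q-top : ∀ n k → q (2 ℕ.+ r) n k ≈ 0#
    q-top n k = begin
      q (2 ℕ.+ r) n k              ≈⟨ constant-on-ℤ (λ n → q (2 ℕ.+ r) n k) step n (n₀ ℤ.+ 1ℤ) ⟩
      q (2 ℕ.+ r) (n₀ ℤ.+ 1ℤ) k    ≡⟨ ≡.cong (q (2 ℕ.+ r) (n₀ ℤ.+ 1ℤ)) k≡ ⟩
      q (2 ℕ.+ r) (n₀ ℤ.+ 1ℤ) (n₀ ℤ.+ 1ℤ ℤ.+ + suc r)  ≈⟨ q-vanishes r ℕ.≤-refl n₀ ⟩
      0#                           ∎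
      where
      -- Solves `n₀ + 1 + (r + 1) = k`, the position of the zero at the time `n₀ + 1`.
      n₀ = k ℤ.- + (2 ℕ.+ r)
      k≡ : k ≡ n₀ ℤ.+ 1ℤ ℤ.+ + suc r
      k≡ = ≡.sym (≡.trans (+-+-assoc n₀ 1 (suc r))
        (≡.trans (ℤ.+-assoc k (ℤ.- + (2 ℕ.+ r)) (+ (2 ℕ.+ r)))
          (≡.trans (≡.cong (λ x → k ℤ.+ x) (ℤ.+-inverseˡ (+ (2 ℕ.+ r)))) (ℤ.+-identityʳ k))))
      step : ∀ n → q (2 ℕ.+ r) (n ℤ.+ 1ℤ) k ≈ q (2 ℕ.+ r) n k
      step n = trans (q-next (suc r) ℕ.≤-refl n k)
        (trans (+-congˡ (trans (*-congʳ (trans (-‿cong (ye-top n)) -0#≈0#)) (zeroˡ _))) (+-identityʳ _))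

    -- The polynomial in t with coefficients `s`, restricted to degrees below `d`, applied to the
    -- sequence R_1 and evaluated at `k`; the signs are those of the powers of t.
    applied : ∀ d → (ℕ → Carrier) → ℤ → Carrier
    applied d s k = ∑ K λ (j : Fin d) → (- 1#) ^ toℕ j * s (toℕ j) * σ 2 (k ℤ.- + toℕ j)

    applied-shift : ∀ d s k → applied (suc d) (shift s) k ≈ - applied d s (k ℤ.- 1ℤ)
    applied-shift d s k = begin
      1# * 0# * σ 2 (k ℤ.- 0ℤ) + (∑ K λ (j : Fin d) → (- 1#) ^ suc (toℕ j) * s (toℕ j) * σ 2 (k ℤ.- + suc (toℕ j)))
        ≈⟨ +-cong (trans (*-congʳ (zeroʳ _)) (zeroˡ _)) (sum-cong-≋ summand) ⟩
      0# + ∑ K (λ j → - 1# * t j)  ≈⟨ +-identityˡ _ ⟩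
      ∑ K (λ j → - 1# * t j)       ≈⟨ *-distribˡ-sum (- 1#) t ⟨
      - 1# * ∑ K t                 ≈⟨ -1*x≈-x _ ⟩
      - ∑ K t                      ∎
      where
      t : Fin d → Carrier
      t j = (- 1#) ^ toℕ j * s (toℕ j) * σ 2 (k ℤ.- 1ℤ ℤ.- + toℕ j)
      minus-suc : ∀ j → k ℤ.- + suc j ≡ k ℤ.- 1ℤ ℤ.- + j
      minus-suc j = ≡.trans (≡.cong (λ x → k ℤ.+ x) (ℤ.neg-distrib-+ 1ℤ (+ j)))
                            (≡.sym (ℤ.+-assoc k -1ℤ (ℤ.- + j)))
      summand : ∀ j → (- 1#) ^ suc (toℕ j) * s (toℕ j) * σ 2 (k ℤ.- + suc (toℕ j)) ≈ - 1# * t j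
      summand j = trans (*-cong (*-assoc _ _ _) (reflexive (≡.cong (σ 2) (minus-suc (toℕ j))))) (*-assoc _ _ _)

    applied-linear : ∀ d {b e} {s t u : ℕ → Carrier} → (∀ j → u j ≈ b * s j + e * t j) →
      ∀ k → applied d u k ≈ b * applied d s k + e * applied d t k
    applied-linear d {b} {e} {s} {t} {u} eq k = begin
      applied d u k                                                    ≈⟨ sum-cong-≋ {d} summand ⟩
      ∑ K (λ (j : Fin d) → b * term s j + e * term t j)                ≈⟨ ∑-distrib-+ (λ j → b * term s j) (λ j → e * term t j) ⟩
      ∑ K (λ (j : Fin d) → b * term s j) + ∑ K (λ j → e * term t j)
        ≈⟨ +-cong (*-distribˡ-sum b (term s)) (*-distribˡ-sum e (term t)) ⟨
      b * applied d s k + e * applied d t k                            ∎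
      where
      term : (ℕ → Carrier) → Fin d → Carrier
      term s j = (- 1#) ^ toℕ j * s (toℕ j) * σ 2 (k ℤ.- + toℕ j)
      summand : ∀ j → term u j ≈ b * term s j + e * term t j
      summand j = trans (*-congʳ (*-congˡ (eq (toℕ j))))
        (solve 6 (λ ε b e x y a → ε :* (b :* x :+ e :* y) :* a := b :* (ε :* x :* a) :+ e :* (ε :* y :* a)) refl
           ((- 1#) ^ toℕ j) b e (s (toℕ j)) (t (toℕ j)) (σ 2 (k ℤ.- + toℕ j)))

    hardPoly : ℤ → ℕ → ℕ → Carrier
    hardPoly n = F (λ m → ye m n) (λ m → yo m n)

    -- Nothing is cut off: each step of the recursion raises the degree by at most one, so `F m` has
    -- no coefficient at `m` or beyond.
    q-applied : ∀ m d → m ℕ.≤ d → ∀ n k → q m n k ≈ applied d (hardPoly n m) k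
    q-applied zero d _ n k = sym (sum-zero {d} _ λ j → trans (*-congʳ (zeroʳ _)) (zeroˡ _))
    q-applied (suc zero) (suc d) _ n k = sym (begin
      1# * 1# * σ 2 (k ℤ.- 0ℤ) + _
        ≈⟨ +-cong (trans (*-congʳ (*-identityˡ _)) (trans (*-identityˡ _) (reflexive (≡.cong (σ 2) (ℤ.+-identityʳ k)))))
             (sum-zero {d} (λ j → (- 1#) ^ suc (toℕ j) * 0# * σ 2 (k ℤ.- + suc (toℕ j)))
                λ j → trans (*-congʳ (zeroʳ _)) (zeroˡ _)) ⟩
      σ 2 k + 0#  ≈⟨ +-identityʳ _ ⟩
      σ 2 k       ∎)
    q-applied (suc (suc m)) (suc d) (ℕ.s≤s m<d) n k = sym (begin
      applied (suc d) (P (2 ℕ.+ m)) k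
        ≈⟨ applied-linear (suc d) {s = P (suc m)} {t = G _ _ m} (λ j → sym (+-cong (*-identityˡ _) (*-identityˡ _))) k ⟩
      1# * applied (suc d) (P (suc m)) k + 1# * applied (suc d) (G (λ m → ye m n) (λ m → yo m n) m) k
        ≈⟨ +-cong (*-identityˡ _) (*-identityˡ _) ⟩
      applied (suc d) (P (suc m)) k + applied (suc d) (G (λ m → ye m n) (λ m → yo m n) m) k
        ≈⟨ +-congˡ (applied-linear (suc d) {s = shift (P (suc m))} {t = shift (P m)} (λ j → refl) k) ⟩
      applied (suc d) (P (suc m)) k
        + (yo m n * applied (suc d) (shift (P (suc m))) k + ye m n * applied (suc d) (shift (P m)) k)
        ≈⟨ +-cong (sym (q-applied (suc m) (suc d) (ℕ.m≤n⇒m≤1+n m<d) n k))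
             (+-cong (shifted (yo m n) (suc m) m<d) (shifted (ye m n) m (ℕ.<⇒≤ m<d))) ⟩
      q (2 ℕ.+ m) n k ∎)
      where
      P = hardPoly n
      shifted : ∀ x m → m ℕ.≤ d → x * applied (suc d) (shift (P m)) k ≈ - x * q m n (k ℤ.- 1ℤ)
      shifted x m m≤d = begin
        x * applied (suc d) (shift (P m)) k   ≈⟨ *-congˡ (applied-shift d (P m) k) ⟩
        x * - applied d (P m) (k ℤ.- 1ℤ)      ≈⟨ -‿distribʳ-* _ _ ⟨
        - (x * applied d (P m) (k ℤ.- 1ℤ))    ≈⟨ -‿distribˡ-* _ _ ⟩
        - x * applied d (P m) (k ℤ.- 1ℤ)      ≈⟨ *-congˡ (q-applied m d m≤d n (k ℤ.- 1ℤ)) ⟨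
        - x * q m n (k ℤ.- 1ℤ)                ∎

    q-cong : ∀ m {n n′ k k′} → n ≡ n′ → k ≡ k′ → q m n k ≈ q m n′ k′
    q-cong m ≡.refl ≡.refl = refl

    -- By q-suc-next, subtracting a multiple of each column from the next one
    -- passes from level m to level m + 1, and q-vanishes clears the first row.
    det-q : ∀ s m → m ℕ.+ s ℕ.≤ suc r → ∀ n →
      det K s (λ i l → q (suc m) (n ℤ.+ + toℕ l) (n ℤ.+ + suc (m ℕ.+ toℕ i ℕ.+ toℕ l))) * σ (suc m) n
        ≈ σ (suc (m ℕ.+ s)) (n ℤ.+ + s)
    det-q zero m _ n = trans (*-identityˡ _)
      (reflexive (≡.cong₂ σ (≡.cong suc (≡.sym (ℕ.+-identityʳ m))) (≡.sym (ℤ.+-identityʳ n))))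
    det-q (suc s) m m+s<1+r n = begin
      det K (suc s) M * σ (suc m) n
        ≈⟨ *-congʳ (det-column-operations M (λ l → wl m (n ℤ.+ + toℕ l)) N (λ i → refl) modified) ⟨
      det K (suc s) N * σ (suc m) n
        ≈⟨ *-congʳ (det-first-row s {N} first-row) ⟩
      N zero zero * det K s (λ i l → N (suc i) (suc l)) * σ (suc m) n
        ≈⟨ *-congʳ (*-cong (trans (q-cong (suc m) (ℤ.+-identityʳ n) (≡.cong (λ x → n ℤ.+ + suc x) m+0+0≡m)) (q-leading m m≤1+r n))
             (det-cong s remaining)) ⟩
      -- The factor `σ (suc m) n` cancels the denominator of the corner entry R_{m+1,n+1} / R_{m,n};
      -- its numerator is the factor required at level `suc m` and time n + 1.
      σ (2 ℕ.+ m) n⁺ * τ (suc m) n * D * σ (suc m) n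
        ≈⟨ solve 4 (λ s₂ i D s₁ → s₂ :* i :* D :* s₁ := D :* s₂ :* (s₁ :* i)) refl
             (σ (2 ℕ.+ m) n⁺) (τ (suc m) n) D (σ (suc m) n) ⟩
      D * σ (2 ℕ.+ m) n⁺ * (σ (suc m) n * τ (suc m) n)
        ≈⟨ *-unitʳ (σ-τ m m≤1+r n) ⟩
      D * σ (2 ℕ.+ m) n⁺
        ≈⟨ det-q s (suc m) (ℕ.≤-trans (ℕ.≤-reflexive (≡.sym (ℕ.+-suc m s))) m+s<1+r) n⁺ ⟩
      σ (suc (suc m ℕ.+ s)) (n⁺ ℤ.+ + s)
        ≡⟨ ≡.cong₂ σ (≡.cong suc (≡.sym (ℕ.+-suc m s))) (+-+-assoc n 1 s) ⟩
      σ (suc (m ℕ.+ suc s)) (n ℤ.+ + suc s) ∎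
      where
      n⁺ = n ℤ.+ 1ℤ
      m≤r : m ℕ.≤ r
      m≤r = ℕ.s≤s⁻¹ (ℕ.≤-trans (ℕ.s≤s (ℕ.m≤m+n m s)) (ℕ.≤-trans (ℕ.≤-reflexive (≡.sym (ℕ.+-suc m s))) m+s<1+r))
      m≤1+r = ℕ.m≤n⇒m≤1+n m≤r
      m+0+0≡m : m ℕ.+ 0 ℕ.+ 0 ≡ m
      m+0+0≡m = ≡.trans (ℕ.+-identityʳ _) (ℕ.+-identityʳ m)
      M N : Matrix (suc s)
      M i l = q (suc m) (n ℤ.+ + toℕ l) (n ℤ.+ + suc (m ℕ.+ toℕ i ℕ.+ toℕ l))
      N i zero    = M i zero
      N i (suc l) = q (2 ℕ.+ m) (n ℤ.+ + suc (toℕ l)) (n ℤ.+ + suc (m ℕ.+ toℕ i ℕ.+ suc (toℕ l)))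
      D = det K s (λ i l → q (2 ℕ.+ m) (n⁺ ℤ.+ + toℕ l) (n⁺ ℤ.+ + suc (suc m ℕ.+ toℕ i ℕ.+ toℕ l)))
      next : ∀ a → n ℤ.+ + suc a ≡ n ℤ.+ + a ℤ.+ 1ℤ
      next a = ≡.sym (≡.trans (+-+-assoc n a 1) (≡.cong (λ x → n ℤ.+ + x) (ℕ.+-comm a 1)))
      modified : ∀ i l → N i (suc l) ≈ M i (suc l) + wl m (n ℤ.+ + toℕ l) * M i (inject₁ l)
      modified i l = begin
        q (2 ℕ.+ m) (n ℤ.+ + suc (toℕ l)) k      ≈⟨ q-cong (2 ℕ.+ m) (next (toℕ l)) ≡.refl ⟩
        q (2 ℕ.+ m) (n ℤ.+ + toℕ l ℤ.+ 1ℤ) k     ≈⟨ q-suc-next m m≤r (n ℤ.+ + toℕ l) k ⟩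
        q (suc m) (n ℤ.+ + toℕ l ℤ.+ 1ℤ) k + wl m (n ℤ.+ + toℕ l) * q (suc m) (n ℤ.+ + toℕ l) (k ℤ.- 1ℤ)
          ≈⟨ +-cong (q-cong (suc m) (≡.sym (next (toℕ l))) ≡.refl)
               (*-congˡ (q-cong (suc m) (≡.cong (λ x → n ℤ.+ + x) (≡.sym (Fin.toℕ-inject₁ l))) k-pred)) ⟩
        M i (suc l) + wl m (n ℤ.+ + toℕ l) * M i (inject₁ l) ∎
        where
        k = n ℤ.+ + suc (m ℕ.+ toℕ i ℕ.+ suc (toℕ l))
        k-pred : k ℤ.- 1ℤ ≡ n ℤ.+ + suc (m ℕ.+ toℕ i ℕ.+ toℕ (inject₁ l))
        k-pred = ≡.trans (+-suc-pred n (m ℕ.+ toℕ i ℕ.+ suc (toℕ l)))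
          (≡.cong (λ x → n ℤ.+ + x) (≡.trans (ℕ.+-suc _ (toℕ l))
            (≡.cong (λ x → suc (m ℕ.+ toℕ i ℕ.+ x)) (≡.sym (Fin.toℕ-inject₁ l)))))
      first-row : ∀ l → N zero (suc l) ≈ 0#
      first-row l = trans (q-cong (2 ℕ.+ m) (next (toℕ l)) k≡) (q-vanishes m m≤r (n ℤ.+ + toℕ l))
        where
        k≡ : n ℤ.+ + suc (m ℕ.+ 0 ℕ.+ suc (toℕ l)) ≡ n ℤ.+ + toℕ l ℤ.+ 1ℤ ℤ.+ + suc m
        k≡ = ≡.sym (≡.trans (≡.cong (ℤ._+ + suc m) (≡.sym (next (toℕ l))))
          (≡.trans (+-+-assoc n (suc (toℕ l)) (suc m))
            (≡.cong (λ x → n ℤ.+ + suc x) (≡.trans (ℕ.+-comm (toℕ l) (suc m))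
              (≡.trans (≡.sym (ℕ.+-suc m (toℕ l)))
                (≡.cong (ℕ._+ suc (toℕ l)) (≡.sym (ℕ.+-identityʳ m))))))))
      remaining : ∀ i l → N (suc i) (suc l) ≈
        q (2 ℕ.+ m) (n⁺ ℤ.+ + toℕ l) (n⁺ ℤ.+ + suc (suc m ℕ.+ toℕ i ℕ.+ toℕ l))
      remaining i l = q-cong (2 ℕ.+ m) (≡.sym (+-+-assoc n 1 (toℕ l)))
        (≡.sym (≡.trans (+-+-assoc n 1 _) (≡.cong (λ x → n ℤ.+ + suc x)
          (≡.sym (≡.trans (ℕ.+-suc (m ℕ.+ suc (toℕ i)) (toℕ l)) (≡.cong (λ x → suc (x ℕ.+ toℕ l)) (ℕ.+-suc m (toℕ i))))))))

    sign-square : ∀ a → (- 1#) ^ a * (- 1#) ^ a ≈ 1#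
    sign-square zero    = *-identityˡ _
    sign-square (suc a) = begin
      - 1# * (- 1#) ^ a * (- 1# * (- 1#) ^ a)
        ≈⟨ solve 2 (λ m x → m :* x :* (m :* x) := m :* m :* (x :* x)) refl (- 1#) ((- 1#) ^ a) ⟩
      - 1# * - 1# * ((- 1#) ^ a * (- 1#) ^ a)  ≈⟨ *-cong (-x*-y≈x*y 1# 1#) (sign-square a) ⟩
      1# * 1# * 1#                             ≈⟨ trans (*-identityʳ _) (*-identityʳ _) ⟩
      1#                                       ∎

    -- The coefficients of `F`, reversed and with alternating signs, form a kernel vector whose last
    -- entry is the constant coefficient 1, so `kernel-minors` reads off all minors. `n` and `n₀`
    -- are unrelated because `q-top` holds at every time and index; independence of the base point
    -- comes with it.
    hankelMinor-hardPoly : ∀ n n₀ (k : Fin (2 ℕ.+ r)) →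
      det K (suc r) (λ i j → σ 2 (n₀ ℤ.+ + suc (toℕ i ℕ.+ toℕ (punchIn (opposite k) j))))
        ≈ hardPoly n (2 ℕ.+ r) (toℕ k)
    hankelMinor-hardPoly n n₀ k = begin
      Δ                                  ≈⟨ *-identityˡ _ ⟨
      1# * Δ                             ≈⟨ *-congʳ (sign-square a) ⟨
      ε a * ε a * Δ                      ≈⟨ *-assoc _ _ _ ⟩
      ε a * (ε a * Δ)                    ≈⟨ *-congˡ (kernel-minors (suc r) M v kernel v-last (opposite k)) ⟩
      ε a * (ε (suc r) * (v (opposite k) * det K (suc r) (λ i j → M i (punchIn (fromℕ (suc r)) j))))
        -- Splitting the exponent as `a + k = r + 1` makes every sign occur twice.
        ≈⟨ *-congˡ (*-cong (trans (reflexive (≡.cong ε (≡.sym a+k≡1+r))) (^-homo-* (- 1#) a (toℕ k))) (*-unitʳ hankel≈1)) ⟩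
      ε a * (ε a * ε (toℕ k) * v (opposite k))
        ≡⟨ ≡.cong (λ x → ε a * (ε a * ε (toℕ k) * (ε (toℕ x) * P (toℕ x)))) (Fin.opposite-involutive k) ⟩
      ε a * (ε a * ε (toℕ k) * (ε (toℕ k) * P (toℕ k)))
        ≈⟨ solve 3 (λ x z p → x :* (x :* z :* (z :* p)) := p :* (x :* x) :* (z :* z)) refl (ε a) (ε (toℕ k)) (P (toℕ k)) ⟩
      P (toℕ k) * (ε a * ε a) * (ε (toℕ k) * ε (toℕ k))
        ≈⟨ trans (*-unitʳ (sign-square (toℕ k))) (*-unitʳ (sign-square a)) ⟩
      P (toℕ k) ∎
      where
      P = hardPoly n (2 ℕ.+ r)
      ε : ℕ → Carrier
      ε m = (- 1#) ^ m
      M : Fin (suc r) → Fin (2 ℕ.+ r) → Carrier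
      M i l = σ 2 (n₀ ℤ.+ + suc (toℕ i ℕ.+ toℕ l))
      Δ = det K (suc r) (λ i j → M i (punchIn (opposite k) j))
      v : Fin (2 ℕ.+ r) → Carrier
      v l = ε (toℕ (opposite l)) * P (toℕ (opposite l))
      a = toℕ (opposite k)
      opposite-+ : ∀ (l : Fin (2 ℕ.+ r)) → toℕ (opposite l) ℕ.+ toℕ l ≡ suc r
      opposite-+ l = ≡.trans (≡.cong (ℕ._+ toℕ l) (Fin.opposite-prop l)) (ℕ.m∸n+n≡m (ℕ.s≤s⁻¹ (Fin.toℕ<n l)))
      a+k≡1+r = opposite-+ k
      v-last : v (fromℕ (suc r)) ≈ 1#
      v-last = trans (reflexive (≡.cong (λ x → ε x * P x)
          (ℕ.+-cancelʳ-≡ (suc r) _ 0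
            (≡.trans (≡.cong (toℕ (opposite (fromℕ (suc r))) ℕ.+_) (≡.sym (Fin.toℕ-fromℕ (suc r)))) (opposite-+ (fromℕ (suc r)))))))
        (trans (*-identityˡ _) (F-constant _ _ (suc r)))
      kernel : ∀ i → (∑ K λ l → M i l * v l) ≈ 0#
      kernel i = begin
        (∑ K λ l → M i l * v l)                        ≈⟨ sum-permute (λ l → M i l * v l) Permutation.reverse ⟩
        (∑ K λ j → M i (opposite j) * v (opposite j))  ≈⟨ sum-cong-≋ summand ⟩
        applied (2 ℕ.+ r) P k′                          ≈⟨ q-applied (2 ℕ.+ r) (2 ℕ.+ r) ℕ.≤-refl n k′ ⟨
        q (2 ℕ.+ r) n k′                                ≈⟨ q-top n k′ ⟩
        0#                                              ∎
        where
        -- The largest index in row `i`; `applied` counts downwards from it, hence the reversal of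
        -- the columns.
        k′ = n₀ ℤ.+ + suc (toℕ i ℕ.+ suc r)
        index : ∀ j → n₀ ℤ.+ + suc (toℕ i ℕ.+ toℕ (opposite j)) ≡ k′ ℤ.- + toℕ j
        index j = ≡.sym (≡.trans (≡.cong (λ x → n₀ ℤ.+ + suc (toℕ i ℕ.+ x) ℤ.- + toℕ j) (≡.sym (opposite-+ j)))
          (≡.trans (≡.cong (λ x → n₀ ℤ.+ + suc x ℤ.- + toℕ j) (≡.sym (ℕ.+-assoc (toℕ i) _ (toℕ j))))
          (≡.trans (≡.cong (ℤ._- + toℕ j) (≡.sym (+-+-assoc n₀ (suc (toℕ i ℕ.+ toℕ (opposite j))) (toℕ j))))
          (≡.trans (ℤ.+-assoc (n₀ ℤ.+ + suc (toℕ i ℕ.+ toℕ (opposite j))) (+ toℕ j) (ℤ.- + toℕ j))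
          (≡.trans (≡.cong (λ x → n₀ ℤ.+ + suc (toℕ i ℕ.+ toℕ (opposite j)) ℤ.+ x) (ℤ.+-inverseʳ (+ toℕ j)))
            (ℤ.+-identityʳ _))))))
        summand : ∀ j → M i (opposite j) * v (opposite j) ≈ ε (toℕ j) * P (toℕ j) * σ 2 (k′ ℤ.- + toℕ j)
        summand j = trans (*-comm _ _) (*-cong
          (reflexive (≡.cong (λ x → ε (toℕ x) * P (toℕ x)) (Fin.opposite-involutive j)))
          (reflexive (≡.cong (σ 2) (index j))))
      hankel≈1 : det K (suc r) (λ i j → M i (punchIn (fromℕ (suc r)) j)) ≈ 1#
      hankel≈1 = begin
        det K (suc r) (λ i j → M i (punchIn (fromℕ (suc r)) j))
          ≈⟨ det-cong (suc r) (λ i j → reflexive (≡.cong (λ x → σ 2 (n₀ ℤ.+ + suc (toℕ i ℕ.+ x))) (toℕ-punchIn-last j))) ⟩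
        det K (suc r) (λ i j → σ 2 (n₀ ℤ.+ + suc (toℕ i ℕ.+ toℕ j)))  ≈⟨ *-unitʳ (σ-one n₀) ⟨
        det K (suc r) (λ i j → σ 2 (n₀ ℤ.+ + suc (toℕ i ℕ.+ toℕ j))) * σ 1 n₀  ≈⟨ det-q (suc r) 0 ℕ.≤-refl n₀ ⟩
        σ (2 ℕ.+ r) (n₀ ℤ.+ + suc r)  ≈⟨ σ-last _ ⟩
        1# ∎

-- Application to the given Q-system.

private module ℤSolver = IntegerSolver.+-*-Solver

parity-evenVertex : ∀ {r} (i : Fin r) → parity r (suc (evenVertex i)) ≡ inj₂ i
parity-evenVertex zero    = ≡.refl
parity-evenVertex (suc i) = ≡.cong (Sum.map suc suc) (parity-evenVertex i)

parity-oddVertex : ∀ {r} (i : Fin r) → parity r (suc (oddVertex i)) ≡ inj₁ (suc i)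
parity-oddVertex zero    = ≡.refl
parity-oddVertex (suc i) = ≡.cong (Sum.map suc suc) (parity-oddVertex i)

extend : ∀ {a} {A : Set a} {n} → A → (Fin n → A) → ℕ → A
extend {n = zero}  d f m       = d
extend {n = suc n} d f zero    = f zero
extend {n = suc n} d f (suc m) = extend d (f ∘ suc) m

extend-toℕ : ∀ {a} {A : Set a} {n} (d : A) (f : Fin n → A) i → extend d f (toℕ i) ≡ f i
extend-toℕ d f zero    = ≡.refl
extend-toℕ d f (suc i) = extend-toℕ d (f ∘ suc) i

extend-length : ∀ {a} {A : Set a} {n} (d : A) (f : Fin n → A) → extend d f n ≡ d
extend-length {n = zero}  d f = ≡.refl
extend-length {n = suc n} d f = extend-length d (f ∘ suc)

module QSystemInstance {c ℓ₁ ℓ₂} (K : HeytingField c ℓ₁ ℓ₂) {r : ℕ}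
  {X₀ X₁ : Fin r → HeytingField.Carrier K} {R : Fin (2 ℕ.+ r) → ℤ → HeytingField.Carrier K}
  (Q : IsQSystem K X₀ X₁ R) where

  open HeytingField K using (_#_; #⇒invertible)
  open HeytingCommutativeRing (HeytingField.heytingCommutativeRing K) using (commutativeRing)
  open HeytingCommutativeRingProperties (HeytingField.heytingCommutativeRing K) using (x-0≈x)
  open CommutativeRing commutativeRing hiding (zero)
  open SemiringSolver commutativeSemiring using (solve; _:*_; _:=_)
  open SetoidReasoning setoid
  open PartitionFunction K using (Z-F)
  open IsQSystem Q

  x*x⁻¹≈1 : ∀ {x} (x#0 : x # 0#) → x * proj₁ (#⇒invertible x#0) ≈ 1#
  x*x⁻¹≈1 x#0 = trans (*-congʳ (sym (x-0≈x _))) (proj₂ (proj₂ (#⇒invertible x#0)))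

  -- Inverses are unique. `divide` inverts a product in one piece, while `τ` provides the inverse
  -- factor by factor.
  divide-≈ : ∀ x {d d⁻¹} (d#0 : d # 0#) → d * d⁻¹ ≈ 1# → divide K x d d#0 ≈ x * d⁻¹
  divide-≈ x {d} {d⁻¹} d#0 d*d⁻¹≈1 = *-congˡ (begin
    i              ≈⟨ *-unitʳ K d*d⁻¹≈1 ⟨
    i * (d * d⁻¹)  ≈⟨ solve 3 (λ i d e → i :* (d :* e) := e :* (d :* i)) refl i d d⁻¹ ⟩
    d⁻¹ * (d * i)  ≈⟨ *-unitʳ K (x*x⁻¹≈1 d#0) ⟩
    d⁻¹            ∎)
    where
    i = proj₁ (#⇒invertible d#0)

  -- The clause of `σ` for `zero` is R_(-1) = 0, and the default value of `extend` is R_{r+2} = 0.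
  σ τ : ℕ → ℤ → Carrier
  σ zero    n = 0#
  σ (suc m) n = extend 0# (λ α → R α n) m
  τ zero    n = 0#
  τ (suc m) n = extend 0# (λ α → proj₁ (#⇒invertible (nonzero α n))) m

  σ-at : ∀ α {m} → toℕ α ≡ m → ∀ n → σ (suc m) n ≡ R α n
  σ-at α ≡.refl n = extend-toℕ 0# (λ α → R α n) α

  τ-at : ∀ α {m} → toℕ α ≡ m → ∀ n → τ (suc m) n ≡ proj₁ (#⇒invertible (nonzero α n))
  τ-at α ≡.refl n = extend-toℕ 0# (λ α → proj₁ (#⇒invertible (nonzero α n))) α

  σ-at*τ-at : ∀ α {m} → toℕ α ≡ m → ∀ n → σ (suc m) n * τ (suc m) n ≈ 1#
  σ-at*τ-at α α≡m n = trans (reflexive (≡.cong₂ _*_ (σ-at α α≡m n) (τ-at α α≡m n))) (x*x⁻¹≈1 (nonzero α n))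

  σ-τ : ∀ m → m ℕ.≤ suc r → ∀ n → σ (suc m) n * τ (suc m) n ≈ 1#
  σ-τ m m≤1+r = σ-at*τ-at (fromℕ< (ℕ.s≤s m≤1+r)) (Fin.toℕ-fromℕ< (ℕ.s≤s m≤1+r))

  σ-last : ∀ n → σ (2 ℕ.+ r) n ≈ 1#
  σ-last n = trans (reflexive (σ-at (fromℕ (suc r)) (Fin.toℕ-fromℕ (suc r)) n)) (top n)

  σ-top : ∀ n → σ (3 ℕ.+ r) n ≈ 0#
  σ-top n = reflexive (extend-length 0# (λ α → R α n))

  -- At both ends the relation reads 1 * 1 = 1 * 1 + 0 by the conventions; in between it is the
  -- relation of the Q-system centred at n + 1.
  σ-relation : ∀ m → m ℕ.≤ suc r → ∀ n →
    σ (suc m) (n ℤ.+ 1ℤ ℤ.+ 1ℤ) * σ (suc m) n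
      ≈ σ (suc m) (n ℤ.+ 1ℤ) * σ (suc m) (n ℤ.+ 1ℤ) + σ (2 ℕ.+ m) (n ℤ.+ 1ℤ) * σ m (n ℤ.+ 1ℤ)
  σ-relation zero _ n = begin
    R zero (n ℤ.+ 1ℤ ℤ.+ 1ℤ) * R zero n          ≈⟨ *-cong (bottom _) (bottom _) ⟩
    1# * 1#                                      ≈⟨ *-cong (bottom _) (bottom _) ⟨
    R zero (n ℤ.+ 1ℤ) * R zero (n ℤ.+ 1ℤ)        ≈⟨ trans (+-congˡ (zeroʳ _)) (+-identityʳ _) ⟨
    R zero (n ℤ.+ 1ℤ) * R zero (n ℤ.+ 1ℤ) + R (suc zero) (n ℤ.+ 1ℤ) * 0# ∎
  σ-relation (suc m) (ℕ.s≤s m≤r) n with ℕ.m≤n⇒m<n∨m≡n m≤r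
  ... | inj₂ ≡.refl = begin
    σ (2 ℕ.+ r) (n⁺ ℤ.+ 1ℤ) * σ (2 ℕ.+ r) n                              ≈⟨ *-cong (σ-last _) (σ-last _) ⟩
    1# * 1#                                                              ≈⟨ *-cong (σ-last _) (σ-last _) ⟨
    σ (2 ℕ.+ r) n⁺ * σ (2 ℕ.+ r) n⁺                                      ≈⟨ +-identityʳ _ ⟨
    σ (2 ℕ.+ r) n⁺ * σ (2 ℕ.+ r) n⁺ + 0#                                 ≈⟨ +-congˡ (trans (*-congʳ (σ-top _)) (zeroˡ _)) ⟨
    σ (2 ℕ.+ r) n⁺ * σ (2 ℕ.+ r) n⁺ + σ (3 ℕ.+ r) n⁺ * σ (1 ℕ.+ r) n⁺    ∎
    where
    n⁺ = n ℤ.+ 1ℤ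
  ... | inj₁ m<r = begin
    σ (2 ℕ.+ m) (n⁺ ℤ.+ 1ℤ) * σ (2 ℕ.+ m) n
      ≡⟨ ≡.cong₂ _*_ (self _) (≡.trans (self n) (≡.cong (R (self′ α)) n≡n⁺-1)) ⟩
    R (self′ α) (n⁺ ℤ.+ 1ℤ) * R (self′ α) (n⁺ ℤ.- 1ℤ)  ≈⟨ relation α n⁺ ⟩
    R (self′ α) n⁺ * R (self′ α) n⁺ + R (succ′ α) n⁺ * R (pred′ α) n⁺
      ≡⟨ ≡.cong₂ _+_ (≡.cong₂ _*_ (self n⁺) (self n⁺))
           (≡.cong₂ _*_ (σ-at (succ′ α) (≡.cong (2 ℕ.+_) α≡m) n⁺) (σ-at (pred′ α) pred≡m n⁺)) ⟨
    σ (2 ℕ.+ m) n⁺ * σ (2 ℕ.+ m) n⁺ + σ (3 ℕ.+ m) n⁺ * σ (1 ℕ.+ m) n⁺ ∎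
    where
    n⁺ = n ℤ.+ 1ℤ
    α = fromℕ< m<r
    α≡m : toℕ α ≡ m
    α≡m = Fin.toℕ-fromℕ< m<r
    pred≡m : toℕ (pred′ α) ≡ m
    pred≡m = ≡.trans (Fin.toℕ-inject₁ (inject₁ α)) (≡.trans (Fin.toℕ-inject₁ α) α≡m)
    self : ∀ k → σ (2 ℕ.+ m) k ≡ R (self′ α) k
    self = σ-at (self′ α) (≡.trans (Fin.toℕ-inject₁ (suc α)) (≡.cong suc α≡m))
    n≡n⁺-1 : n ≡ n⁺ ℤ.- 1ℤ
    n≡n⁺-1 = ≡.sym (≡.trans (ℤ.+-assoc n 1ℤ -1ℤ) (ℤ.+-identityʳ n))

  open QSystem K r σ τ (λ _ → refl) bottom σ-last σ-top σ-τ σ-relation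

  divide-στ : ∀ {n n′} α β γ δ {a b d e} → toℕ α ≡ a → toℕ β ≡ b → toℕ γ ≡ d → toℕ δ ≡ e →
    (γδ#0 : R γ n * R δ n′ # 0#) →
    divide K (R α n * R β n′) (R γ n * R δ n′) γδ#0
      ≈ σ (suc a) n * σ (suc b) n′ * (τ (suc d) n * τ (suc e) n′)
  divide-στ {n} {n′} α β γ δ {a} {b} {d} {e} α≡a β≡b γ≡d δ≡e γδ#0 = begin
    divide K (R α n * R β n′) (R γ n * R δ n′) γδ#0
      ≈⟨ divide-≈ _ γδ#0 inverse ⟩
    R α n * R β n′ * (τ (suc d) n * τ (suc e) n′)
      ≡⟨ ≡.cong (_* (τ (suc d) n * τ (suc e) n′)) (≡.cong₂ _*_ (σ-at α α≡a n) (σ-at β β≡b n′)) ⟨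
    σ (suc a) n * σ (suc b) n′ * (τ (suc d) n * τ (suc e) n′) ∎
    where
    inverse : R γ n * R δ n′ * (τ (suc d) n * τ (suc e) n′) ≈ 1#
    inverse = begin
      R γ n * R δ n′ * (τ (suc d) n * τ (suc e) n′)
        ≡⟨ ≡.cong (_* (τ (suc d) n * τ (suc e) n′)) (≡.cong₂ _*_ (σ-at γ γ≡d n) (σ-at δ δ≡e n′)) ⟨
      σ (suc d) n * σ (suc e) n′ * (τ (suc d) n * τ (suc e) n′)
        ≈⟨ solve 4 (λ s t u v → s :* t :* (u :* v) := (s :* u) :* (t :* v)) refl
             (σ (suc d) n) (σ (suc e) n′) (τ (suc d) n) (τ (suc e) n′) ⟩
      σ (suc d) n * τ (suc d) n * (σ (suc e) n′ * τ (suc e) n′)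
        ≈⟨ trans (*-unitʳ K (σ-at*τ-at δ δ≡e n′)) (σ-at*τ-at γ γ≡d n) ⟩
      1# ∎

  y-even : ∀ n (i : Fin r) → y K Q n (suc (evenVertex i)) ≈ ye (suc (toℕ i)) n
  y-even n i rewrite parity-evenVertex i =
    divide-στ (pred′ i) (succ′ i) (self′ i) (self′ i)
      (≡.trans (Fin.toℕ-inject₁ (inject₁ i)) (Fin.toℕ-inject₁ i)) ≡.refl
      (Fin.toℕ-inject₁ (suc i)) (Fin.toℕ-inject₁ (suc i)) _

  y-odd : ∀ n (i : Fin r) → y K Q n (suc (oddVertex i)) ≈ yo (suc (toℕ i)) n
  y-odd n i rewrite parity-oddVertex i =
    divide-στ (inject₁ (suc i)) (suc (suc i)) (suc (suc i)) (inject₁ (suc i))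
      (Fin.toℕ-inject₁ (suc i)) ≡.refl ≡.refl (Fin.toℕ-inject₁ (suc i)) _

  y-first : ∀ n → y K Q n zero ≈ yo 0 n
  y-first n = divide-στ zero (suc zero) (suc zero) zero ≡.refl ≡.refl ≡.refl ≡.refl _

  conserved≈Z : ∀ m n (j : Fin (2 ℕ.+ r)) → conserved K R m j ≈ Z K r (toℕ j) (y K Q n)
  conserved≈Z m n j = begin
    conserved K R m j
      ≈⟨ Determinant.det-cong K (suc r) (λ i l → reflexive (≡.cong (R (suc zero)) (index i (punchIn (opposite j) l)))) ⟩
    det K (suc r) (λ i l → σ 2 (n₀ ℤ.+ + suc (toℕ i ℕ.+ toℕ (punchIn (opposite j) l))))
      ≈⟨ hankelMinor-hardPoly n n₀ j ⟩
    hardPoly n (2 ℕ.+ r) (toℕ j)  ≡⟨ ≡.cong (λ k → hardPoly n k (toℕ j)) (ℕ.+-comm 2 r) ⟩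
    hardPoly n (r ℕ.+ 2) (toℕ j)
      ≈⟨ Z-F _ _ r (y K Q n) (y-first n) (y-even n) (y-odd n) (toℕ j) ⟨
    Z K r (toℕ j) (y K Q n) ∎
    where
    -- The corner entry of the Hankel matrix has index m - r - 1, which has to be `n₀ + 1`.
    n₀ = m ℤ.- + (2 ℕ.+ r)
    index : ∀ (i : Fin (suc r)) (l : Fin (2 ℕ.+ r)) →
      m ℤ.+ + label (punchIn (fromℕ (suc r)) i) ℤ.+ + label l ℤ.- + (r ℕ.+ 3) ≡ n₀ ℤ.+ + suc (toℕ i ℕ.+ toℕ l)
    index i l = ≡.trans
      (≡.cong (λ x → m ℤ.+ + suc x ℤ.+ + label l ℤ.- + (r ℕ.+ 3)) (toℕ-punchIn-last i))
      (ℤSolver.solve 4 (λ m a b r →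
         m ℤSolver.:+ (one ℤSolver.:+ a) ℤSolver.:+ (one ℤSolver.:+ b) ℤSolver.:- (r ℤSolver.:+ ℤSolver.con (+ 3))
         ℤSolver.:= m ℤSolver.:- (ℤSolver.con (+ 2) ℤSolver.:+ r) ℤSolver.:+ (one ℤSolver.:+ (a ℤSolver.:+ b)))
         ≡.refl m (+ toℕ i) (+ toℕ l) (+ r))
      where
      one : ∀ {k} → ℤSolver.Polynomial k
      one = ℤSolver.con 1ℤ

mainTheorem6 : ∀ {c ℓ₁ ℓ₂} (r : ℕ) → 1 ≤ r →
    (K : HeytingField c ℓ₁ ℓ₂) → let open HeytingField K in
    (X₀ X₁ : Fin r → Carrier) → IsRationalFunctionField K (X₀ ++ X₁) →
    (R : Fin (suc (suc r)) → ℤ → Carrier) (Q : IsQSystem K X₀ X₁ R) →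
    (∀ (m n : ℤ) (j : Fin (suc (suc r))) → conserved K R m j ≈ Z K r (toℕ j) (y K Q n))
    × (∀ (m : ℤ) (j : Fin (suc (suc r))) → conserved K R m j ≈ Z K r (toℕ j) (y⁰ K Q))
-- `0ℤ + 1ℤ` computes to `1ℤ`, so `y⁰` agrees with `y` at 0 by computation.
mainTheorem6 r _ K X₀ X₁ _ R Q = conserved≈Z , λ m j → conserved≈Z m 0ℤ j
  where open QSystemInstance K Q using (conserved≈Z)
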